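{- Let $P$ be a path on $n$ vertices, let $I, J$ be two $k$-path vertex covers of $P$, and let $u$ be a positive integer. Then one can decide in linear time whether $I$ and $J$ are reconfigurable under $\mathsf{TAR}(u)$.
   Context: Fix an integer $k \geq 2$. A $k$-path is a path on $k$ vertices. A vertex subset $I \subseteq V(G)$ is a $k$-path vertex cover of $G$ if every $k$-path in $G$ contains at least one vertex of $I$. For a positive integer $u$, a sequence $\langle I_0, \dots, I_\ell \rangle$ of $k$-path vertex covers of $G$ is a $\mathsf{TAR}(u)$-sequence between $I_0$ and $I_\ell$ if $|I_i| \le u$ for all $i$ and $|I_i \Delta I_{i+1}| = 1$ for each $i<\ell$. $I$ and $J$ are reconfigurable under $\mathsf{TAR}(u)$ if such a sequence exists between them. -}

module Defs where

open import Data.Bool.Base using (Bool; true; false; if_then_else_)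
open import Data.Fin.Base using (Fin; toℕ; inject₁; fromℕ)
import Data.Fin.Base as Fin
open import Data.Fin.Permutation using (Permutation′; _⟨$⟩ʳ_)
open import Data.Fin.Subset using (Subset; _∈_; _∪_; _─_; ∣_∣)
open import Data.List.Base
  using (List; []; _∷_; _++_; map; concat; head; drop; length; tabulate)
import Data.List.Membership.Propositional as List
open import Data.List.Relation.Unary.Unique.Propositional using (Unique)
open import Data.List.Scans.Base using (scanl)
open import Data.Maybe.Base using (Maybe; just; nothing; fromMaybe)
open import Data.Nat.Base using (ℕ; zero; suc; _+_; _∸_; _≤_; _≡ᵇ_)
open import Data.Nat.Properties using (1+n≢n)
open import Data.Product.Base using (Σ; ∃; _×_; _,_)
open import Data.Sum.Base using (_⊎_; inj₁; inj₂; swap)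
open import Data.Vec.Base using (toList)
open import Function.Bundles using (_⇔_)
open import Function.Definitions using (Injective)
open import Relation.Binary.PropositionalEquality using (_≡_; sym)
open import Relation.Nullary.Negation using (¬_)
open import Relation.Nullary.Reflects using (Reflects)

------------------------------------------------------------------------
-- Finite simple graphs and paths

record Graph (n : ℕ) : Set₁ where
  field
    Adj        : Fin n → Fin n → Set
    symmetric   : ∀ {v w} → Adj v w → Adj w v
    irreflexive : ∀ {v} → ¬ Adj v v

open Graph public

pathGraph : ∀ n → Graph n
pathGraph n = record
  { Adj         = λ i j → toℕ j ≡ suc (toℕ i) ⊎ toℕ i ≡ suc (toℕ j)
  ; symmetric   = swap
  ; irreflexive = λ { (inj₁ e) → 1+n≢n (sym e) ; (inj₂ e) → 1+n≢n (sym e) }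
  }

IsPath : ∀ {n} → Graph n → Set
IsPath {n} P = Σ (Permutation′ n) λ π →
  ∀ i j → Adj (pathGraph n) i j ⇔ Adj P (π ⟨$⟩ʳ i) (π ⟨$⟩ʳ j)

-- A path on k vertices in G, as a (not necessarily induced) subgraph.
record PathIn {n} (k : ℕ) (G : Graph n) : Set where
  field
    vertex    : Fin k → Fin n
    injective : Injective _≡_ _≡_ vertex
    adjacent  : ∀ i j → Adj (pathGraph k) i j → Adj G (vertex i) (vertex j)

open PathIn public

------------------------------------------------------------------------
-- Path vertex covers and their reconfiguration

IsPathVertexCover : ∀ {n} → ℕ → Graph n → Subset n → Set
IsPathVertexCover k G I = ∀ (p : PathIn k G) → ∃ λ i → vertex p i ∈ I

infixl 5 _△_

_△_ : ∀ {n} → Subset n → Subset n → Subset n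
I △ J = (I ─ J) ∪ (J ─ I)

record TARSequence {n} (k : ℕ) (G : Graph n) (u : ℕ) (I J : Subset n) : Set where
  field
    ℓ       : ℕ
    set     : Fin (suc ℓ) → Subset n
    start   : set Fin.zero ≡ I
    end     : set (fromℕ ℓ) ≡ J
    cover   : ∀ i → IsPathVertexCover k G (set i)
    bounded : ∀ i → ∣ set i ∣ ≤ u
    step    : ∀ (i : Fin ℓ) → ∣ set (inject₁ i) △ set (Fin.suc i) ∣ ≡ 1

-- The existence of a sequence is inhabitation of its type.
Reconfigurable : ∀ {n} → ℕ → Graph n → ℕ → Subset n → Subset n → Set
Reconfigurable = TARSequence

------------------------------------------------------------------------
-- Unit-cost random access machines
--
-- Registers and memory cells hold natural numbers; subtraction is
-- truncated at zero.  Every executed instruction, including the final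
-- halt, costs one unit of time.

data Instruction : Set where
  const     : (r c : ℕ) → Instruction          -- r ← c
  add       : (r s t : ℕ) → Instruction        -- r ← s + t
  sub       : (r s t : ℕ) → Instruction        -- r ← s ∸ t
  load      : (r s : ℕ) → Instruction          -- r ← memory[s]
  store     : (r s : ℕ) → Instruction          -- memory[r] ← s
  jumpIfPos : (r target : ℕ) → Instruction
  halt      : (answer : Bool) → Instruction

Program : Set
Program = List Instruction

record Config : Set where
  constructor config
  field
    pc       : ℕ
    register : ℕ → ℕ
    memory   : ℕ → ℕ

infixl 9 _[_↦_]

_[_↦_] : (ℕ → ℕ) → ℕ → ℕ → (ℕ → ℕ)
(f [ i ↦ x ]) j = if i ≡ᵇ j then x else f j

execute : Instruction → Config → Bool ⊎ Config
execute (const r c)     (config p ρ m) = inj₂ (config (suc p) (ρ [ r ↦ c ]) m)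
execute (add r s t)     (config p ρ m) = inj₂ (config (suc p) (ρ [ r ↦ ρ s + ρ t ]) m)
execute (sub r s t)     (config p ρ m) = inj₂ (config (suc p) (ρ [ r ↦ ρ s ∸ ρ t ]) m)
execute (load r s)      (config p ρ m) = inj₂ (config (suc p) (ρ [ r ↦ m (ρ s) ]) m)
execute (store r s)     (config p ρ m) = inj₂ (config (suc p) ρ (m [ ρ r ↦ ρ s ]))
execute (jumpIfPos r q) (config p ρ m) with ρ r
... | zero  = inj₂ (config (suc p) ρ m)
... | suc _ = inj₂ (config q ρ m)
execute (halt b)        _              = inj₁ b

nth : ∀ {A : Set} → List A → ℕ → Maybe A
nth xs i = head (drop i xs)

-- The answer given within the time bound, if any.  Running off the
-- program gives no answer.
run : Program → (time : ℕ) → Config → Maybe Bool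
run prog zero    c = nothing
run prog (suc t) c with nth prog (Config.pc c)
... | nothing = nothing
... | just i with execute i c
...   | inj₁ b  = just b
...   | inj₂ c′ = run prog t c′

initial : List ℕ → Config
initial input = config 0 (λ _ → 0) (λ a → fromMaybe 0 (nth input a))

-- On this input, prog halts within the time bound and its answer is
-- correct for A.
_on_decides_within_ : Program → List ℕ → Set → ℕ → Set
prog on input decides A within time =
  ∃ λ b → run prog time (initial input) ≡ just b × Reflects A b

------------------------------------------------------------------------
-- Input format

-- The neighbours of each vertex, listed once each in an arbitrary order.
record AdjacencyLists {n} (G : Graph n) : Set where
  field
    neighbours : Fin n → List (Fin n)
    unique     : ∀ v → Unique (neighbours v)
    correct    : ∀ v w → w List.∈ neighbours v ⇔ Adj G v w

open AdjacencyLists public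

characteristic : ∀ {n} → Subset n → List ℕ
characteristic I = map (λ b → if b then 1 else 0) (toList I)

-- n, u, the characteristic vectors of I and J, and the adjacency lists:
-- first n + 1 offsets, then the concatenated lists, where the list of
-- vertex v occupies positions offset v up to (not including)
-- offset (v + 1) of the concatenation.
encode : ∀ {n} {G : Graph n} → AdjacencyLists G → (I J : Subset n) → (u : ℕ) → List ℕ
encode {n} L I J u =
  n ∷ u ∷ characteristic I ++ characteristic J
    ++ scanl _+_ 0 (map length lists) ++ concat lists
  where
  lists : List (List ℕ)
  lists = tabulate λ v → map toℕ (neighbours L v)

{-# OPTIONS --safe #-}

-- On a path, a set of size less than u can be pushed to the canonical cover { k, 2k, … }: sweeping
-- from one end, slide every vertex outside the canonical cover one step further, inserting the new
-- vertex before the old one is removed. Hence two distinct covers of size at most u are reconfigurable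
-- unless one of them is isolated, that is, has size u and no redundant vertex. A vertex of a cover is
-- redundant exactly when its two neighbouring vertices in the cover, or the ends of the path, are
-- close enough, so one walk along the path detects redundancy. The machine finds an end of the path
-- by degrees and recovers each next vertex as the sum of two neighbours minus the previous vertex.
module Submission where

open import Defs
open import Data.Bool.Base using (Bool; true; false; not; if_then_else_; T)
open import Data.Fin.Base using (Fin; toℕ; fromℕ; fromℕ<; inject₁)
import Data.Fin.Base as Fin
open import Data.Fin.Permutation using (_⟨$⟩ʳ_; _⟨$⟩ˡ_; inverseʳ)
import Data.Fin.Properties as Fin
open import Data.Fin.Subset using (Subset; _∈_; _─_; ∣_∣)
open import Data.Fin.Subset.Properties using (∪-comm)
open import Data.List.Base using (List; []; _∷_; _++_; map; concat; length; take; tabulate)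
open import Data.List.Membership.Propositional using () renaming (_∈_ to _∈ˡ_)
open import Data.List.Properties using (length-map; length-tabulate)
import Data.List.Relation.Unary.All as All
open import Data.List.Relation.Unary.AllPairs using (_∷_)
open import Data.List.Relation.Unary.Any using (here; there)
open import Data.List.Relation.Unary.Unique.Propositional using (Unique)
open import Data.List.Scans.Base using (scanl)
open import Data.Maybe.Base using (Maybe; just; fromMaybe)
open import Data.Nat.Base
open import Data.Nat.Divisibility
open import Data.Nat.DivMod using (_mod_; m<n⇒m%n≡m; m%n<n; m≡m%n+[m/n]*n)
open import Data.Nat.ListAction using (sum)
open import Data.Nat.Properties
open import Data.Nat.Solver using (module +-*-Solver)
open import Data.Product.Base using (Σ; ∃; _×_; _,_; proj₁; proj₂)
open import Data.Sum.Base using (_⊎_; inj₁; inj₂; swap)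
open import Data.Unit.Base using (⊤)
open import Data.Vec.Base using ([]; _∷_; lookup; _[_]%=_)
open import Data.Vec.Properties using (lookup∘updateAt; lookup∘updateAt′; []=⇒lookup; lookup⇒[]=)
open import Function.Base using (_∘_; case_of_)
open import Function.Bundles using (Equivalence; Injection)
open import Function.Definitions using (Injective)
open import Function.Properties.Inverse using (↔⇒↣)
open import Relation.Binary.Construct.Closure.ReflexiveTransitive
  using (Star; ε; _◅_; _◅◅_; reverse)
open import Relation.Binary.Definitions using (tri<; tri≈; tri>)
open import Relation.Binary.PropositionalEquality
open import Relation.Nullary.Decidable using (yes; no; does; dec-true)
open import Relation.Nullary.Negation using (¬_; contradiction)
open import Relation.Nullary.Reflects using (Reflects; ofʸ; ofⁿ)

-- Single-vertex changes of a vertex set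

-- A slide leaves no k-path uncovered because everything behind the sweep is already canonical: a
-- vertex outside the canonical cover lies close enough after the last canonical one that the gap up
-- to its successor is still shorter than k. The spare unit of the bound is spent on the insertion
-- and regained by the removal, so the sweep can go on. The obstacle on the machine's side is that
-- the numbers of the vertices say nothing about their order along the path, and the two neighbours
-- of a vertex are listed in either order. The combinatorics is therefore stated for positions in an
-- arbitrary traversal, and the traversal is fixed only once the machine has found an end. The two
-- covers are tested independently by the same code.

toggle : ∀ {n} → Fin n → Subset n → Subset n
toggle v A = A [ v ]%= not

∣△-self∣ : ∀ {n} (A : Subset n) → ∣ A △ A ∣ ≡ 0
∣△-self∣ []          = refl
∣△-self∣ (true ∷ A)  = ∣△-self∣ A
∣△-self∣ (false ∷ A) = ∣△-self∣ A

∣△∣≡0 : ∀ {n} (A B : Subset n) → ∣ A △ B ∣ ≡ 0 → A ≡ B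
∣△∣≡0 []          []          _ = refl
∣△∣≡0 (true ∷ A)  (true ∷ B)  e = cong (true ∷_) (∣△∣≡0 A B e)
∣△∣≡0 (false ∷ A) (false ∷ B) e = cong (false ∷_) (∣△∣≡0 A B e)

∣△-toggle∣ : ∀ {n} v (A : Subset n) → ∣ A △ toggle v A ∣ ≡ 1
∣△-toggle∣ Fin.zero    (true ∷ A)  = cong suc (∣△-self∣ A)
∣△-toggle∣ Fin.zero    (false ∷ A) = cong suc (∣△-self∣ A)
∣△-toggle∣ (Fin.suc v) (true ∷ A)  = ∣△-toggle∣ v A
∣△-toggle∣ (Fin.suc v) (false ∷ A) = ∣△-toggle∣ v A

∣△∣≡1 : ∀ {n} (A B : Subset n) → ∣ A △ B ∣ ≡ 1 → ∃ λ v → B ≡ toggle v A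
∣△∣≡1 []          []          ()
∣△∣≡1 (true ∷ A)  (true ∷ B)  e = let v , eq = ∣△∣≡1 A B e in Fin.suc v , cong (true ∷_) eq
∣△∣≡1 (false ∷ A) (false ∷ B) e = let v , eq = ∣△∣≡1 A B e in Fin.suc v , cong (false ∷_) eq
∣△∣≡1 (true ∷ A)  (false ∷ B) e = Fin.zero , cong (false ∷_) (sym (∣△∣≡0 A B (suc-injective e)))
∣△∣≡1 (false ∷ A) (true ∷ B)  e = Fin.zero , cong (true ∷_) (sym (∣△∣≡0 A B (suc-injective e)))

∣△∣-comm : ∀ {n} (A B : Subset n) → ∣ A △ B ∣ ≡ ∣ B △ A ∣
∣△∣-comm A B = cong ∣_∣ (∪-comm (A ─ B) (B ─ A))

∣toggle∣-remove : ∀ {n} v (A : Subset n) → lookup A v ≡ true → suc ∣ toggle v A ∣ ≡ ∣ A ∣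
∣toggle∣-remove Fin.zero    (true ∷ A)  _ = refl
∣toggle∣-remove (Fin.suc v) (true ∷ A)  e = cong suc (∣toggle∣-remove v A e)
∣toggle∣-remove (Fin.suc v) (false ∷ A) e = ∣toggle∣-remove v A e

∣toggle∣-insert : ∀ {n} v (A : Subset n) → lookup A v ≡ false → ∣ toggle v A ∣ ≡ suc ∣ A ∣
∣toggle∣-insert Fin.zero    (false ∷ A) _ = refl
∣toggle∣-insert (Fin.suc v) (true ∷ A)  e = cong suc (∣toggle∣-insert v A e)
∣toggle∣-insert (Fin.suc v) (false ∷ A) e = ∣toggle∣-insert v A e

lookup-injective : ∀ {n} (A B : Subset n) → (∀ v → lookup A v ≡ lookup B v) → A ≡ B
lookup-injective []      []      _ = refl
lookup-injective (a ∷ A) (b ∷ B) e = cong₂ _∷_ (e Fin.zero) (lookup-injective A B (e ∘ Fin.suc))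

-- Reconfiguration as a reflexive transitive closure

Feasible : ∀ {n} → ℕ → Graph n → ℕ → Subset n → Set
Feasible k G u A = IsPathVertexCover k G A × ∣ A ∣ ≤ u

-- Asking feasibility at both ends makes the relation symmetric, so chains can be reversed. Only the
-- empty chain carries no feasibility, which is why `fromTAR` and `toTAR` treat it separately.
Move : ∀ {n} → ℕ → Graph n → ℕ → Subset n → Subset n → Set
Move k G u A B = Feasible k G u A × Feasible k G u B × ∣ A △ B ∣ ≡ 1

module _ {n k u : ℕ} {G : Graph n} where

  Move-sym : ∀ {A B} → Move k G u A B → Move k G u B A
  Move-sym {A} {B} (a , b , e) = b , a , trans (∣△∣-comm B A) e

  fromTAR : ∀ {A B} → Reconfigurable k G u A B → Feasible k G u A × Star (Move k G u) A B
  fromTAR s =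
    subst (Feasible k G u) start (feasible Fin.zero) ,
    subst₂ (Star (Move k G u)) start end (chain ℓ set feasible step)
    where
    open TARSequence s
    feasible : ∀ i → Feasible k G u (set i)
    feasible i = cover i , bounded i
    chain : ∀ ℓ (f : Fin (suc ℓ) → Subset n) → (∀ i → Feasible k G u (f i)) →
            (∀ (i : Fin ℓ) → ∣ f (inject₁ i) △ f (Fin.suc i) ∣ ≡ 1) →
            Star (Move k G u) (f Fin.zero) (f (fromℕ ℓ))
    chain zero    f c s = ε
    chain (suc ℓ) f c s = (c _ , c _ , s Fin.zero) ◅ chain ℓ (f ∘ Fin.suc) (c ∘ Fin.suc) (s ∘ Fin.suc)

  toTAR : ∀ {A B} → Feasible k G u A → Star (Move k G u) A B → Reconfigurable k G u A B
  toTAR {A} (c , b) ε = record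
    { ℓ = 0 ; set = λ _ → A ; start = refl ; end = refl
    ; cover = λ _ → c ; bounded = λ _ → b ; step = λ () }
  toTAR {A} (c , b) ((_ , f , e) ◅ ms) = record
    { ℓ       = suc (ℓ rest)
    ; set     = λ { Fin.zero → A ; (Fin.suc i) → set rest i }
    ; start   = refl
    ; end     = end rest
    ; cover   = λ { Fin.zero → c ; (Fin.suc i) → cover rest i }
    ; bounded = λ { Fin.zero → b ; (Fin.suc i) → bounded rest i }
    ; step    = λ { Fin.zero → trans (cong (λ B → ∣ A △ B ∣) (start rest)) e
                  ; (Fin.suc i) → step rest i }
    }
    where
    open TARSequence
    rest = toTAR f ms

-- Path orders

-- Positions are natural numbers, so that windows and gaps can be computed without casts; the axioms
-- speak only of positions below `n`.
record Traversal {n} (G : Graph n) : Set where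
  field
    vertexAt    : ℕ → Fin n
    distinct    : ∀ {p q} → p < n → q < n → vertexAt p ≡ vertexAt q → p ≡ q
    exhaustive  : ∀ v → ∃ λ p → p < n × vertexAt p ≡ v
    linked      : ∀ {p} → suc p < n → Adj G (vertexAt p) (vertexAt (suc p))
    consecutive : ∀ {p q} → p < n → q < n → Adj G (vertexAt p) (vertexAt q) →
                  q ≡ suc p ⊎ p ≡ suc q

traversal : ∀ {n} {P : Graph n} → 1 ≤ n → IsPath P → Traversal P
traversal {n@(suc _)} {P} _ (π , iso) = record
  { vertexAt    = λ p → π ⟨$⟩ʳ (p mod n)
  ; distinct    = λ {p} {q} p<n q<n e → begin
      p             ≡⟨ toℕ-mod p<n ⟨
      toℕ (p mod n) ≡⟨ cong toℕ (Injection.injective (↔⇒↣ π) e) ⟩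
      toℕ (q mod n) ≡⟨ toℕ-mod q<n ⟩
      q             ∎
  ; exhaustive  = λ v → toℕ (π ⟨$⟩ˡ v) , Fin.toℕ<n _ ,
      trans (cong (π ⟨$⟩ʳ_) (Fin.toℕ-injective (toℕ-mod (Fin.toℕ<n _)))) (inverseʳ π)
  ; linked      = λ {p} p+1<n → Equivalence.to (iso _ _)
      (inj₁ (trans (toℕ-mod p+1<n) (cong suc (sym (toℕ-mod (<-trans (n<1+n p) p+1<n))))))
  ; consecutive = λ {p} {q} p<n q<n a →
      subst₂ (λ x y → y ≡ suc x ⊎ x ≡ suc y) (toℕ-mod p<n) (toℕ-mod q<n)
        (Equivalence.from (iso _ _) a)
  }
  where
  open ≡-Reasoning
  toℕ-mod : ∀ {p} → p < n → toℕ (p mod n) ≡ p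
  toℕ-mod {p} p<n = trans (Fin.toℕ-fromℕ< (m%n<n p n)) (m<n⇒m%n≡m p<n)

-- The end that the machine finds may be the last vertex of the given order.
reverseTraversal : ∀ {n} {G : Graph n} → Traversal G → Traversal G
reverseTraversal {n} {G} T = record
  { vertexAt    = λ p → vertexAt (mirror p)
  ; distinct    = λ p<n q<n e →
      mirror-injective p<n q<n (distinct (mirror-< p<n) (mirror-< q<n) e)
  ; exhaustive  = λ v → let p , p<n , e = exhaustive v in
      mirror p , mirror-< p<n , trans (cong vertexAt (mirror-involutive p<n)) e
  ; linked      = λ {p} p+1<n → Graph.symmetric G
      (subst (Adj G (vertexAt (mirror (suc p))) ∘ vertexAt) (mirror-suc p+1<n)
        (linked (subst (_< n) (sym (mirror-suc p+1<n)) (mirror-< (<-trans (n<1+n _) p+1<n)))))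
  ; consecutive = λ p<n q<n a → mirror-consecutive p<n q<n
      (consecutive (mirror-< p<n) (mirror-< q<n) a)
  }
  where
  open Traversal T
  mirror : ℕ → ℕ
  mirror p = n ∸ suc p
  mirror-< : ∀ {p} → p < n → mirror p < n
  mirror-< {p} p<n = ∸-monoʳ-< z<s p<n
  mirror-suc : ∀ {p} → suc p < n → suc (mirror (suc p)) ≡ mirror p
  mirror-suc p+1<n = sym (+-∸-assoc 1 p+1<n)
  mirror-involutive : ∀ {p} → p < n → mirror (mirror p) ≡ p
  mirror-involutive {p} p<n = begin
    n ∸ suc (n ∸ suc p) ≡⟨ cong (n ∸_) (+-∸-assoc 1 p<n) ⟨
    n ∸ (n ∸ p)         ≡⟨ m∸[m∸n]≡n (<⇒≤ p<n) ⟩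
    p                   ∎
    where open ≡-Reasoning
  mirror-injective : ∀ {p q} → p < n → q < n → mirror p ≡ mirror q → p ≡ q
  mirror-injective p<n q<n e =
    trans (sym (mirror-involutive p<n)) (trans (cong mirror e) (mirror-involutive q<n))
  ahead : ∀ {p q} → p < n → q < n → mirror q ≡ suc (mirror p) → p ≡ suc q
  ahead {p} {q} p<n q<n e = suc-injective (∸-cancelˡ-≡ p<n q+1<n (suc-injective (begin
    suc (n ∸ suc p)       ≡⟨ e ⟨
    n ∸ suc q             ≡⟨ mirror-suc q+1<n ⟨
    suc (n ∸ suc (suc q)) ∎)))
    where
    open ≡-Reasoning
    -- The mirror image of the last position is 0, which is no successor.
    q+1<n : suc q < n
    q+1<n = ≤∧≢⇒< q<n λ { refl → 1+n≢0 (trans (sym e) (n∸n≡0 n)) }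
  mirror-consecutive : ∀ {p q} → p < n → q < n →
    mirror q ≡ suc (mirror p) ⊎ mirror p ≡ suc (mirror q) → q ≡ suc p ⊎ p ≡ suc q
  mirror-consecutive p<n q<n (inj₁ e) = inj₂ (ahead p<n q<n e)
  mirror-consecutive p<n q<n (inj₂ e) = inj₁ (ahead q<n p<n e)

-- Covers along a traversal

-- An injective walk with unit steps never turns round.
monotone : ∀ m (q : Fin (suc m) → ℕ) → Injective _≡_ _≡_ q →
           (∀ (i : Fin m) → q (Fin.suc i) ≡ suc (q (inject₁ i)) ⊎ q (inject₁ i) ≡ suc (q (Fin.suc i))) →
           (∀ i → q i ≡ q Fin.zero + toℕ i) ⊎ (∀ i → q i + toℕ i ≡ q Fin.zero)
monotone zero    q inj s = inj₁ λ { Fin.zero → sym (+-identityʳ _) }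
monotone (suc m) q inj s
  with s Fin.zero | monotone m (q ∘ Fin.suc) (Fin.suc-injective ∘ inj) (s ∘ Fin.suc)
... | inj₁ up | inj₁ asc = inj₁ λ
  { Fin.zero    → sym (+-identityʳ _)
  ; (Fin.suc i) → trans (asc i) (trans (cong (_+ toℕ i) up) (sym (+-suc _ (toℕ i)))) }
... | inj₂ down | inj₂ desc = inj₂ λ
  { Fin.zero    → +-identityʳ _
  ; (Fin.suc i) → trans (+-suc _ (toℕ i)) (trans (cong suc (desc i)) (sym down)) }
-- The tail is a single point, which counts as either direction, so the first step decides.
monotone (suc zero) q inj s | inj₁ up | inj₂ _ = inj₁ λ
  { Fin.zero → sym (+-identityʳ _) ; (Fin.suc Fin.zero) → trans up (+-comm 1 _) }
monotone (suc zero) q inj s | inj₂ down | inj₁ _ = inj₂ λ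
  { Fin.zero → +-identityʳ _ ; (Fin.suc Fin.zero) → trans (+-comm _ 1) (sym down) }
-- A turn after the first step brings the walk back to its starting value.
monotone (suc (suc m)) q inj s | inj₁ up | inj₂ desc = contradiction
  (inj {Fin.suc (Fin.suc Fin.zero)} {Fin.zero}
    (suc-injective (trans (+-comm 1 _) (trans (desc (Fin.suc Fin.zero)) up)))) λ ()
monotone (suc (suc m)) q inj s | inj₂ down | inj₁ asc = contradiction
  (inj {Fin.suc (Fin.suc Fin.zero)} {Fin.zero}
    (trans (asc (Fin.suc Fin.zero)) (trans (+-comm _ 1) (sym down)))) λ ()

-- The walk is monotone, so its values fill an interval that starts at its first or at its last
-- value.
window-⊆-image : ∀ m (q : Fin (suc m) → ℕ) → Injective _≡_ _≡_ q →
  (∀ (i : Fin m) → q (Fin.suc i) ≡ suc (q (inject₁ i)) ⊎ q (inject₁ i) ≡ suc (q (Fin.suc i))) →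
  ∃ λ j → ∀ {d} → d ≤ m → ∃ λ i → q i ≡ j + d
window-⊆-image m q inj s with monotone m q inj s
... | inj₁ asc = q Fin.zero , λ d≤m → fromℕ< (s≤s d≤m) ,
  trans (asc _) (cong (q Fin.zero +_) (Fin.toℕ-fromℕ< (s≤s d≤m)))
... | inj₂ desc = q (fromℕ m) , λ {d} d≤m → let m-d<1+m = s≤s (m∸n≤m m d) in
  fromℕ< m-d<1+m , +-cancelʳ-≡ (m ∸ d) _ _ (begin
    q (fromℕ< m-d<1+m) + (m ∸ d)                  ≡⟨ cong (q (fromℕ< m-d<1+m) +_) (Fin.toℕ-fromℕ< m-d<1+m) ⟨
    q (fromℕ< m-d<1+m) + toℕ (fromℕ< m-d<1+m)     ≡⟨ desc _ ⟩
    q Fin.zero                                    ≡⟨ desc (fromℕ m) ⟨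
    q (fromℕ m) + toℕ (fromℕ m)                   ≡⟨ cong (q (fromℕ m) +_) (Fin.toℕ-fromℕ m) ⟩
    q (fromℕ m) + m                               ≡⟨ cong (q (fromℕ m) +_) (m+[n∸m]≡n d≤m) ⟨
    q (fromℕ m) + (d + (m ∸ d))                   ≡⟨ +-assoc _ d (m ∸ d) ⟨
    q (fromℕ m) + d + (m ∸ d)                     ∎)
  where open ≡-Reasoning

module Ordered {n : ℕ} {G : Graph n} (T : Traversal G) (k : ℕ) where
  open Traversal T

  mark : Subset n → ℕ → Bool
  mark A p = lookup A (vertexAt p)

  -- The cover condition freed from the graph: on a path, the k-paths are exactly the windows of k
  -- consecutive positions.
  Dense : Subset n → Set
  Dense A = ∀ j → j + k ≤ n → ∃ λ p → j ≤ p × p < j + k × mark A p ≡ true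

  cover⇒dense : ∀ {A} → IsPathVertexCover k G A → Dense A
  cover⇒dense {A} cov j j+k≤n = let i , v∈A = cov window in
    j + toℕ i , m≤m+n j _ , +-monoʳ-< j (Fin.toℕ<n i) , []=⇒lookup v∈A
    where
    j+i<n : ∀ (i : Fin k) → j + toℕ i < n
    j+i<n i = <-≤-trans (+-monoʳ-< j (Fin.toℕ<n i)) j+k≤n
    forward : ∀ (i i′ : Fin k) → toℕ i′ ≡ suc (toℕ i) → Adj G (vertexAt (j + toℕ i)) (vertexAt (j + toℕ i′))
    forward i i′ e = subst (Adj G (vertexAt (j + toℕ i)) ∘ vertexAt) (sym e′)
      (linked (subst (_< n) e′ (j+i<n i′)))
      where e′ = trans (cong (j +_) e) (+-suc j (toℕ i))
    window : PathIn k G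
    window = record
      { vertex    = λ i → vertexAt (j + toℕ i)
      ; injective = λ {i} {i′} e → Fin.toℕ-injective
          (+-cancelˡ-≡ j _ _ (distinct (j+i<n i) (j+i<n i′) e))
      ; adjacent  = λ { i i′ (inj₁ e) → forward i i′ e
                      ; i i′ (inj₂ e) → Graph.symmetric G (forward i′ i e) }
      }

  dense⇒cover : ∀ {A} → Dense A → IsPathVertexCover k G A
  dense⇒cover {A} dense p = helper k refl p dense
    where
    -- The copy `k′` permits a case split on the module parameter. For k = 0 density is absurd,
    -- since an empty window contains no mark.
    helper : ∀ k′ → k′ ≡ k → (p : PathIn k′ G) → Dense A → ∃ λ i → vertex p i ∈ A
    helper zero refl p dense with dense 0 z≤n
    ... | _ , _ , () , _
    helper (suc m) refl p dense = let q , j≤q , q<j+k , q∈A = dense j j+k≤n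
                                      i , e = image (d≤m j≤q q<j+k) in
      i , lookup⇒[]= _ A (trans (cong (lookup A) (trans (sym (position-vertex i))
        (cong vertexAt (trans e (m+[n∸m]≡n j≤q))))) q∈A)
      where
      position : Fin (suc m) → ℕ
      position i = proj₁ (exhaustive (vertex p i))
      position<n : ∀ i → position i < n
      position<n i = proj₁ (proj₂ (exhaustive (vertex p i)))
      position-vertex : ∀ i → vertexAt (position i) ≡ vertex p i
      position-vertex i = proj₂ (proj₂ (exhaustive (vertex p i)))
      steps : ∀ (i : Fin m) → position (Fin.suc i) ≡ suc (position (inject₁ i)) ⊎
                              position (inject₁ i) ≡ suc (position (Fin.suc i))
      steps i = consecutive (position<n _) (position<n _)
        (subst₂ (Adj G) (sym (position-vertex _)) (sym (position-vertex _))
          (adjacent p (inject₁ i) (Fin.suc i) (inj₁ (cong suc (sym (Fin.toℕ-inject₁ i))))))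
      position-injective : Injective _≡_ _≡_ position
      position-injective {i} {i′} e = injective p
        (trans (sym (position-vertex i)) (trans (cong vertexAt e) (position-vertex i′)))
      found = window-⊆-image m position position-injective steps
      j = proj₁ found
      image : ∀ {d} → d ≤ m → ∃ λ i → position i ≡ j + d
      image = proj₂ found
      j+k≤n : j + suc m ≤ n
      j+k≤n = let i , e = image ≤-refl in
        subst (_≤ n) (trans (cong suc e) (sym (+-suc j m))) (position<n i)
      d≤m : ∀ {q} → j ≤ q → q < j + suc m → q ∸ j ≤ m
      d≤m {q} j≤q q<j+k = m≤n+o⇒m∸n≤o q j (s≤s⁻¹ (subst (q <_) (+-suc j m) q<j+k))

  mark-toggle : ∀ A p → mark (toggle (vertexAt p) A) p ≡ not (mark A p)
  mark-toggle A p = lookup∘updateAt (vertexAt p) A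

  mark-toggle-≢ : ∀ A {p q} → p < n → q < n → q ≢ p → mark (toggle (vertexAt p) A) q ≡ mark A q
  mark-toggle-≢ A {p} {q} p<n q<n q≢p =
    lookup∘updateAt′ (vertexAt q) (vertexAt p) (q≢p ∘ distinct q<n p<n) A

  dense-insert : ∀ {A p} → mark A p ≡ false → Dense A → Dense (toggle (vertexAt p) A)
  dense-insert {A} {p} e dense j j+k≤n = let q , j≤q , q<j+k , q∈A = dense j j+k≤n in
    q , j≤q , q<j+k ,
    trans (lookup∘updateAt′ (vertexAt q) (vertexAt p)
      (λ v≡w → contradiction (trans (sym q∈A) (trans (cong (lookup A) v≡w) e)) λ ()) A) q∈A

  -- The only mark among the at least k positions from `b` to before `i` is `p`; without it the
  -- window starting at `b` is empty.
  ¬dense-remove : ∀ {A b i p} → b ≤ p → p < i → i ≤ n → b + k ≤ i →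
    (∀ {q} → b ≤ q → q < p → mark A q ≡ false) →
    (∀ {q} → p < q → q < i → mark A q ≡ false) →
    mark A p ≡ true → ¬ Dense (toggle (vertexAt p) A)
  ¬dense-remove {A} {b} {i} {p} b≤p p<i i≤n b+k≤i before after p∈A dense
    with dense b (≤-trans b+k≤i i≤n)
  ... | q , b≤q , q<b+k , q∈A with <-cmp q p
  ... | tri< q<p _ _ = contradiction (trans (sym (before b≤q q<p))
          (trans (sym (mark-toggle-≢ A (<-≤-trans p<i i≤n) (<-trans q<p (<-≤-trans p<i i≤n)) (<⇒≢ q<p))) q∈A)) λ ()
  ... | tri≈ _ refl _ = contradiction (trans (sym q∈A) (trans (mark-toggle A p) (cong not p∈A))) λ ()
  ... | tri> _ _ p<q = contradiction (trans (sym (after p<q (<-≤-trans q<b+k b+k≤i)))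
          (trans (sym (mark-toggle-≢ A (<-≤-trans p<i i≤n) (<-≤-trans q<b+k (≤-trans b+k≤i i≤n)) (>⇒≢ p<q))) q∈A)) λ ()

  -- A marked position q is recorded by its end suc q, so that 0 can stand for the start of the path.
  Boundary : Subset n → ℕ → Set
  Boundary A b = b ≡ 0 ⊎ ∃ λ q → b ≡ suc q × mark A q ≡ true

  -- A window that relied on `p` either starts before `b` and contains the mark just before `b`, or
  -- it starts at `b` or later and so reaches past `i`. In the latter case it contains the mark `i`;
  -- if `i` is the end of the path, it would not fit.
  dense-remove : ∀ {A b i p} → b ≤ p → p < i → i ≤ n → i < b + k →
    Boundary A b → i ≡ n ⊎ mark A i ≡ true →
    Dense A → Dense (toggle (vertexAt p) A)
  dense-remove {A} {b} {i} {p} b≤p p<i i≤n i<b+k left right dense j j+k≤n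
    with dense j j+k≤n
  ... | q , j≤q , q<j+k , q∈A with q ≟ p
  ... | no q≢p = q , j≤q , q<j+k ,
          trans (mark-toggle-≢ A (<-≤-trans p<i i≤n) (<-≤-trans q<j+k j+k≤n) q≢p) q∈A
  ... | yes refl with <-≤-connex j b
  ...   | inj₁ j<b = fromLeft left
    where
    fromLeft : Boundary A b → ∃ λ q → j ≤ q × q < j + k × mark (toggle (vertexAt p) A) q ≡ true
    fromLeft (inj₁ refl) = contradiction j<b λ ()
    fromLeft (inj₂ (q , refl , q∈A)) = q , s≤s⁻¹ j<b , <-trans b≤p q<j+k ,
      trans (mark-toggle-≢ A (<-≤-trans p<i i≤n) (<-trans b≤p (<-≤-trans p<i i≤n)) (<⇒≢ b≤p)) q∈A
  ...   | inj₂ b≤j = fromRight right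
    where
    i<j+k : i < j + k
    i<j+k = <-≤-trans i<b+k (+-monoˡ-≤ k b≤j)
    fromRight : i ≡ n ⊎ mark A i ≡ true → ∃ λ q → j ≤ q × q < j + k × mark (toggle (vertexAt p) A) q ≡ true
    fromRight (inj₁ refl) = contradiction i<j+k (≤⇒≯ j+k≤n)
    fromRight (inj₂ i∈A) = i , ≤-trans j≤q (<⇒≤ p<i) , i<j+k ,
      trans (mark-toggle-≢ A (<-≤-trans p<i i≤n) (<-≤-trans i<j+k j+k≤n) (>⇒≢ p<i)) i∈A

  Removable : Subset n → Set
  Removable A = ∃ λ p → p < n × mark A p ≡ true × Dense (toggle (vertexAt p) A)

  Irredundant : Subset n → Set
  Irredundant A = ∀ {p} → p < n → mark A p ≡ true → ¬ Dense (toggle (vertexAt p) A)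

  -- Sweeping to the canonical cover, and isolated covers

  module Moves (u : ℕ) where

    _⟶*_ : Subset n → Subset n → Set
    _⟶*_ = Star (Move k G u)

    move : ∀ {A} v → Dense A → ∣ A ∣ ≤ u → Dense (toggle v A) → ∣ toggle v A ∣ ≤ u → A ⟶* toggle v A
    move {A} v dA A≤u dB B≤u = ((dense⇒cover dA , A≤u) , (dense⇒cover dB , B≤u) , ∣△-toggle∣ v A) ◅ ε

    Slack : Subset n → Set
    Slack A = Dense A × ∣ A ∣ < u

    remove : ∀ {A p} → mark A p ≡ true → Dense A → ∣ A ∣ ≤ u → Dense (toggle (vertexAt p) A) →
             A ⟶* toggle (vertexAt p) A × Slack (toggle (vertexAt p) A)
    remove {A} {p} p∈A dA A≤u dB = move (vertexAt p) dA A≤u dB (<⇒≤ B<u) , dB , B<u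
      where
      B<u : ∣ toggle (vertexAt p) A ∣ < u
      B<u = subst (_≤ u) (sym (∣toggle∣-remove (vertexAt p) A p∈A)) A≤u

    module _ .{{_ : NonZero k}} where

      canonical : ℕ → Bool
      canonical p = does (k ∣? suc p)

      Canonical : Subset n → ℕ → Set
      Canonical A i = ∀ {p} → p < i → mark A p ≡ canonical p

      -- The boundary is the largest multiple of k up to `suc i`. As k does not divide `suc i`, it
      -- is at most `i` and less than k before `suc i`, which is what `dense-remove` asks in order
      -- to drop `i` when `suc i` is the next boundary.
      last-canonical : ∀ i → canonical i ≡ false →
        ∃ λ b → b ≤ i × suc i < b + k × (∀ A → Canonical A i → Boundary A b)
      last-canonical i ¬c = b , b≤i , i<b+k , boundary
        where
        r = suc i % k
        b = suc i / k * k
        r+b : suc i ≡ r + b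
        r+b = m≡m%n+[m/n]*n (suc i) k
        k∤1+i : ¬ k ∣ suc i
        k∤1+i d = contradiction (trans (sym (dec-true (k ∣? suc i) d)) ¬c) λ ()
        r>0 : 0 < r
        r>0 = n≢0⇒n>0 λ r≡0 → k∤1+i (divides (suc i / k) (trans r+b (cong (_+ b) r≡0)))
        b≤i : b ≤ i
        b≤i = s≤s⁻¹ (subst (suc b ≤_) (sym r+b) (+-monoˡ-≤ b r>0))
        i<b+k : suc i < b + k
        i<b+k = subst₂ _<_ (sym r+b) (+-comm k b) (+-monoˡ-< b (m%n<n (suc i) k))
        boundary : ∀ A → Canonical A i → Boundary A b
        boundary A can = at b b≤i (n∣m*n (suc i / k))
          where
          at : ∀ b → b ≤ i → k ∣ b → Boundary A b
          at zero    _   _ = inj₁ refl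
          at (suc q) q<i d = inj₂ (q , refl , trans (can q<i) (dec-true (k ∣? suc q) d))

      -- The k positions ending at `i` contain a mark. A mark before `i` would be canonical too, but
      -- two canonical positions are at least k apart.
      canonical⇒mark : ∀ {A i} → i < n → Dense A → Canonical A i → canonical i ≡ true → mark A i ≡ true
      canonical⇒mark {A} {i} i<n dA can c with k ∣? suc i
      ... | yes k∣1+i with dA (suc i ∸ k) (subst (_≤ n) (sym (m∸n+n≡m (∣⇒≤ k∣1+i))) i<n)
      ... | q , j≤q , q<j+k , q∈A with m<1+n⇒m<n∨m≡n (subst (q <_) (m∸n+n≡m (∣⇒≤ k∣1+i)) q<j+k)
      ... | inj₂ refl = q∈A
      ... | inj₁ q<i with k ∣? suc q in k∣?1+q
      ...   | no _ = contradiction (trans (sym q∈A) (trans (can q<i) (cong does k∣?1+q))) λ ()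
      ...   | yes k∣1+q = contradiction (∣⇒≤ {{>-nonZero (m<n⇒0<n∸m q<i)}} k∣i∸q) (<⇒≱ gap)
        where
        k∣i∸q : k ∣ i ∸ q
        k∣i∸q = ∣m+n∣m⇒∣n (subst (k ∣_) (sym (cong suc (m+[n∸m]≡n (<⇒≤ q<i)))) k∣1+i) k∣1+q
        gap : i ∸ q < k
        gap = m<n+o⇒m∸n<o i q (subst (i <_) (+-comm k q)
          (≤-trans (m≤n+m∸n (suc i) k) (+-monoʳ-≤ k j≤q)))

      canonical-suc : ∀ A {i} → Canonical A i → mark A i ≡ canonical i → Canonical A (suc i)
      canonical-suc A can e p<1+i with m<1+n⇒m<n∨m≡n p<1+i
      ... | inj₁ p<i  = can p<i
      ... | inj₂ refl = e

      canonical-toggle : ∀ A {i p} → p < n → i ≤ p → Canonical A i → Canonical (toggle (vertexAt p) A) i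
      canonical-toggle A p<n i≤p can q<i =
        trans (mark-toggle-≢ A p<n (<-trans (<-≤-trans q<i i≤p) p<n) (<⇒≢ (<-≤-trans q<i i≤p))) (can q<i)

      -- With a boundary directly to its right, a mark outside the canonical cover is redundant.
      -- Only size at most u is asked, because a slide may have used up the spare unit just before.
      discard : ∀ {A i} → i < n → Dense A → ∣ A ∣ ≤ u → mark A i ≡ true → canonical i ≡ false →
                suc i ≡ n ⊎ mark A (suc i) ≡ true → Canonical A i →
                ∃ λ B → A ⟶* B × Slack B × Canonical B (suc i)
      discard {A} {i} i<n dA A≤u i∈A cᵢ right can =
        let b , b≤i , i<b+k , boundary = last-canonical i cᵢ
            dB = dense-remove {A} b≤i (n<1+n i) i<n i<b+k (boundary A can) right dA
            reach , slack = remove {A} i∈A dA A≤u dB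
        in toggle (vertexAt i) A , reach , slack ,
           canonical-suc (toggle (vertexAt i) A) (canonical-toggle A i<n ≤-refl can)
             (trans (mark-toggle A i) (trans (cong not i∈A) (sym cᵢ)))

      -- A marked position that is not canonical is slid one step to the right.
      canonicalise-at : ∀ {A i} → i < n → Slack A → Canonical A i →
                        ∃ λ B → A ⟶* B × Slack B × Canonical B (suc i)
      canonicalise-at {A} {i} i<n (dA , A<u) can with mark A i in mᵢ | canonical i in cᵢ
      ... | true  | true  = A , ε , (dA , A<u) , canonical-suc A can (trans mᵢ (sym cᵢ))
      ... | false | false = A , ε , (dA , A<u) , canonical-suc A can (trans mᵢ (sym cᵢ))
      ... | false | true  = contradiction (trans (sym mᵢ) (canonical⇒mark {A} i<n dA can cᵢ)) λ ()
      ... | true  | false with m≤n⇒m<n∨m≡n i<n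
      ...   | inj₂ 1+i≡n = discard {A} i<n dA (<⇒≤ A<u) mᵢ cᵢ (inj₁ 1+i≡n) can
      ...   | inj₁ 1+i<n with mark A (suc i) in m₁₊ᵢ
      ...     | true  = discard {A} i<n dA (<⇒≤ A<u) mᵢ cᵢ (inj₂ m₁₊ᵢ) can
      -- The position ahead is inserted while the size is below u; it then serves as the right
      -- boundary that makes `i` redundant.
      ...     | false =
        let C , B⟶C , slack , canC = discard {B} i<n dB B≤u
              (trans (mark-toggle-≢ A 1+i<n i<n (<⇒≢ (n<1+n i))) mᵢ) cᵢ
              (inj₂ (trans (mark-toggle A (suc i)) (cong not m₁₊ᵢ)))
              (canonical-toggle A 1+i<n (n≤1+n i) can)
        in C , move (vertexAt (suc i)) dA (<⇒≤ A<u) dB B≤u ◅◅ B⟶C , slack , canC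
        where
        B = toggle (vertexAt (suc i)) A
        dB : Dense B
        dB = dense-insert {A} m₁₊ᵢ dA
        B≤u : ∣ B ∣ ≤ u
        B≤u = subst (_≤ u) (sym (∣toggle∣-insert (vertexAt (suc i)) A m₁₊ᵢ)) A<u

      canonicalise : ∀ m {i A} → i + m ≡ n → Slack A → Canonical A i →
                     ∃ λ B → A ⟶* B × Canonical B n
      canonicalise zero    {i} {A} e _ can = A , ε , subst (Canonical A) (trans (sym (+-identityʳ i)) e) can
      canonicalise (suc m) {i} e s can =
        let B , A⟶B , sB , canB = canonicalise-at (subst (i <_) e (m<m+n i z<s)) s can
            C , B⟶C , canC = canonicalise m (trans (sym (+-suc i m)) e) sB canB
        in C , A⟶B ◅◅ B⟶C , canC

      canonical-unique : ∀ {A B} → Canonical A n → Canonical B n → A ≡ B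
      canonical-unique {A} {B} canA canB = lookup-injective A B λ v →
        let p , p<n , e = exhaustive v in
        subst (λ v → lookup A v ≡ lookup B v) e (trans (canA p<n) (sym (canB p<n)))

      -- Both covers reach the same canonical one, and moves can be undone.
      slack-connected : ∀ {A B} → Slack A → Slack B → A ⟶* B
      slack-connected {A} {B} sA sB =
        let A′ , A⟶A′ , canA = canonicalise n refl sA λ ()
            B′ , B⟶B′ , canB = canonicalise n refl sB λ ()
        in A⟶A′ ◅◅ subst (A′ ⟶*_) (canonical-unique canA canB) ε ◅◅ reverse Move-sym B⟶B′

      slack-or-removable-connected : ∀ {A B} → Dense A → ∣ A ∣ ≤ u → Dense B → ∣ B ∣ ≤ u →
        ∣ A ∣ < u ⊎ Removable A → ∣ B ∣ < u ⊎ Removable B → A ⟶* B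
      slack-or-removable-connected dA A≤u dB B≤u fA fB =
        let _ , A⟶A′ , sA = loosen dA A≤u fA
            _ , B⟶B′ , sB = loosen dB B≤u fB
        in A⟶A′ ◅◅ slack-connected sA sB ◅◅ reverse Move-sym B⟶B′
        where
        loosen : ∀ {A} → Dense A → ∣ A ∣ ≤ u → ∣ A ∣ < u ⊎ Removable A → ∃ λ A′ → A ⟶* A′ × Slack A′
        loosen dA _ (inj₁ A<u) = _ , ε , dA , A<u
        loosen dA A≤u (inj₂ (_ , _ , p∈A , dA′)) = _ , remove p∈A dA A≤u dA′

    -- No first move exists: an insertion would exceed u, a removal would destroy density.
    tight-isolated : ∀ {A B} → u ≤ ∣ A ∣ → Irredundant A → A ⟶* B → A ≡ B
    tight-isolated _ _ ε = refl
    tight-isolated {A} u≤A irr (_◅_ {j = C} (_ , (coverC , C≤u) , e) _)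
      with ∣△∣≡1 A C e
    ... | v , refl with exhaustive v
    ... | p , p<n , refl with mark A p in mₚ
    ... | true  = contradiction (cover⇒dense coverC) (irr p<n mₚ)
    ... | false = contradiction (subst (_≤ u) (∣toggle∣-insert v A mₚ) C≤u) (<⇒≱ (s≤s u≤A))

  -- What a left-to-right scan remembers after i positions: a is the end of the last
  -- marked position (0 if none), which is redundant if the next boundary is before e.
  record Scanned (A : Subset n) (i a e : ℕ) : Set where
    field
      a≤i     : a ≤ i
      gap     : ∀ {x} → a ≤ x → x < i → mark A x ≡ false
      last    : a ≡ 0 × e ≡ 0 ⊎ ∃ λ b → ∃ λ p → a ≡ suc p × mark A p ≡ true ×
                e ≡ b + k × b ≤ p × Boundary A b × (∀ {x} → b ≤ x → x < p → mark A x ≡ false)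
      earlier : ∀ {x} → suc x < a → mark A x ≡ true → ¬ Dense (toggle (vertexAt x) A)

  -- The value `e` = 0 keeps the truncated difference `e ∸ i` at 0 as long as there is no mark to be
  -- redundant.
  scan-start : ∀ {A} → Scanned A 0 0 0
  scan-start = record { a≤i = z≤n ; gap = λ _ () ; last = inj₁ (refl , refl) ; earlier = λ () }

  scan-removable : ∀ {A i a e} → Scanned A i a e → i ≤ n → i ≡ n ⊎ mark A i ≡ true →
                   0 < e ∸ i → Dense A → Removable A
  scan-removable {A} {i} s i≤n right e>i dA with Scanned.last s
  ... | inj₁ (refl , refl) = contradiction (subst (0 <_) (0∸n≡0 i) e>i) λ ()
  ... | inj₂ (b , p , refl , p∈A , refl , b≤p , left , _) =
    p , <-≤-trans (Scanned.a≤i s) i≤n , p∈A ,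
    dense-remove {A} b≤p (Scanned.a≤i s) i≤n (m∸n≢0⇒n<m (>⇒≢ e>i)) left right dA

  -- Marks before the last are settled by `earlier`, and after the last there are none. The last one
  -- stands alone between its left boundary and `i`, which `e ∸ i ≡ 0` puts at least k apart.
  scan-irredundant : ∀ {A i a e} → Scanned A i a e → i ≤ n → e ∸ i ≡ 0 →
                     ∀ {x} → x < i → mark A x ≡ true → ¬ Dense (toggle (vertexAt x) A)
  scan-irredundant {A} {i} {a} s i≤n e≤i {x} x<i x∈A with <-cmp (suc x) a
  ... | tri< 1+x<a _ _ = Scanned.earlier s 1+x<a x∈A
  ... | tri> _ _ a<1+x = contradiction (trans (sym x∈A) (Scanned.gap s (s≤s⁻¹ a<1+x) x<i)) λ ()
  ... | tri≈ _ refl _ with Scanned.last s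
  ...   | inj₂ (b , _ , refl , _ , refl , b≤x , _ , before) =
    ¬dense-remove {A} b≤x x<i i≤n (m∸n≡0⇒m≤n e≤i) before (Scanned.gap s) x∈A

  -- The mark `i` is the right boundary of the mark before it, which is thereby settled and joins
  -- `earlier`; the old `a` becomes the left boundary of `i`.
  scan-marked : ∀ {A i a e} → Scanned A i a e → i < n → mark A i ≡ true → e ∸ i ≡ 0 →
                Scanned A (suc i) (suc i) (a + k)
  scan-marked {A} {i} {a} s i<n i∈A e≤i = record
    { a≤i     = ≤-refl
    ; gap     = λ i<x x≤i → contradiction i<x (<⇒≱ x≤i)
    ; last    = inj₂ (a , i , refl , i∈A , refl , Scanned.a≤i s , boundary (Scanned.last s) , Scanned.gap s)
    ; earlier = λ x<i → scan-irredundant s (<⇒≤ i<n) e≤i (s≤s⁻¹ x<i)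
    }
    where
    boundary : a ≡ 0 × _ ⊎ (∃ λ b → ∃ λ p → a ≡ suc p × mark A p ≡ true × _) → Boundary A a
    boundary (inj₁ (a≡0 , _)) = inj₁ a≡0
    boundary (inj₂ (_ , p , a≡1+p , p∈A , _)) = inj₂ (p , a≡1+p , p∈A)

  scan-unmarked : ∀ {A i a e} → Scanned A i a e → mark A i ≡ false → Scanned A (suc i) a e
  scan-unmarked s i∉A = record
    { a≤i     = m≤n⇒m≤1+n a≤i
    ; gap     = λ a≤x x<1+i → case m<1+n⇒m<n∨m≡n x<1+i of λ
      { (inj₁ x<i) → gap a≤x x<i ; (inj₂ refl) → i∉A }
    ; last    = last
    ; earlier = earlier
    }
    where open Scanned s

-- The encoded input in memory

bit : Bool → ℕ
bit b = if b then 1 else 0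

cell : List ℕ → ℕ → ℕ
cell xs i = fromMaybe 0 (nth xs i)

cell-++ˡ : ∀ xs {ys i} → i < length xs → cell (xs ++ ys) i ≡ cell xs i
cell-++ˡ (x ∷ xs) {i = zero}  _         = refl
cell-++ˡ (x ∷ xs) {i = suc i} (s≤s i<l) = cell-++ˡ xs i<l

cell-++ʳ : ∀ xs {ys l} → length xs ≡ l → ∀ i → cell (xs ++ ys) (l + i) ≡ cell ys i
cell-++ʳ []       refl i = refl
cell-++ʳ (x ∷ xs) refl i = cell-++ʳ xs refl i

length-characteristic : ∀ {n} (A : Subset n) → length (characteristic A) ≡ n
length-characteristic []      = refl
length-characteristic (_ ∷ A) = cong suc (length-characteristic A)

cell-characteristic : ∀ {n} (A : Subset n) v → cell (characteristic A) (toℕ v) ≡ bit (lookup A v)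
cell-characteristic (_ ∷ A) Fin.zero    = refl
cell-characteristic (_ ∷ A) (Fin.suc v) = cell-characteristic A v

length-scanl : ∀ e xs → length (scanl _+_ e xs) ≡ suc (length xs)
length-scanl e []       = refl
length-scanl e (x ∷ xs) = cong suc (length-scanl (e + x) xs)

cell-scanl : ∀ e xs {i} → i ≤ length xs → cell (scanl _+_ e xs) i ≡ e + sum (take i xs)
cell-scanl e []       {zero}  _         = sym (+-identityʳ e)
cell-scanl e (x ∷ xs) {zero}  _         = sym (+-identityʳ e)
cell-scanl e (x ∷ xs) {suc i} (s≤s i≤l) = trans (cell-scanl (e + x) xs i≤l) (+-assoc e x _)

offset : ∀ {n} → (Fin n → List ℕ) → ℕ → ℕ
offset f i = sum (take i (map length (tabulate f)))

offset-suc : ∀ {n} (f : Fin n → List ℕ) v → offset f (suc (toℕ v)) ≡ offset f (toℕ v) + length (f v)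
offset-suc f Fin.zero    = +-identityʳ _
offset-suc f (Fin.suc v) = trans (cong (length (f Fin.zero) +_) (offset-suc (f ∘ Fin.suc) v))
  (sym (+-assoc (length (f Fin.zero)) _ _))

cell-concat : ∀ {n} (f : Fin n → List ℕ) v {x} → x < length (f v) →
              cell (concat (tabulate f)) (offset f (toℕ v) + x) ≡ cell (f v) x
cell-concat f Fin.zero    x<l = cell-++ˡ (f Fin.zero) x<l
cell-concat f (Fin.suc v) {x} x<l = begin
  cell (f Fin.zero ++ rest) (length (f Fin.zero) + offset (f ∘ Fin.suc) (toℕ v) + x)
    ≡⟨ cong (cell (f Fin.zero ++ rest)) (+-assoc (length (f Fin.zero)) _ x) ⟩
  cell (f Fin.zero ++ rest) (length (f Fin.zero) + (offset (f ∘ Fin.suc) (toℕ v) + x))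
    ≡⟨ cell-++ʳ (f Fin.zero) refl _ ⟩
  cell rest (offset (f ∘ Fin.suc) (toℕ v) + x)
    ≡⟨ cell-concat (f ∘ Fin.suc) v x<l ⟩
  cell (f (Fin.suc v)) x ∎
  where
  open ≡-Reasoning
  rest = concat (tabulate (f ∘ Fin.suc))

-- The addresses are bracketed in the order in which the program adds its registers, so that a
-- symbolic run produces these very expressions.
record Represents {n} {G : Graph n} (L : AdjacencyLists G) (I J : Subset n) (u : ℕ)
                  (m : ℕ → ℕ) : Set where
  field
    n-at         : m 0 ≡ n
    u-at         : m 1 ≡ u
    I-at         : ∀ v → m (2 + toℕ v) ≡ bit (lookup I v)
    J-at         : ∀ v → m (2 + n + toℕ v) ≡ bit (lookup J v)
    degree-at    : ∀ v → m (2 + n + n + toℕ v + 1) ∸ m (2 + n + n + toℕ v) ≡ length (neighbours L v)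
    neighbour-at : ∀ v {x} → x < length (neighbours L v) →
                   m (2 + n + n + n + 1 + m (2 + n + n + toℕ v) + x) ≡ cell (map toℕ (neighbours L v)) x

encode-represents : ∀ {n} {G : Graph n} (L : AdjacencyLists G) (I J : Subset n) u →
                    Represents L I J u (cell (encode L I J u))
encode-represents {n} L I J u = record
  { n-at = refl
  ; u-at = refl
  ; I-at = λ v → trans
      (cell-++ˡ (characteristic I) (subst (toℕ v <_) (sym (length-characteristic I)) (Fin.toℕ<n v)))
      (cell-characteristic I v)
  ; J-at = λ v → trans (afterI (toℕ v)) (trans
      (cell-++ˡ (characteristic J) (subst (toℕ v <_) (sym (length-characteristic J)) (Fin.toℕ<n v)))
      (cell-characteristic J v))
  ; degree-at = λ v → begin
      m (2 + n + n + toℕ v + 1) ∸ m (2 + n + n + toℕ v)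
        ≡⟨ cong₂ _∸_ (trans (cong m (trans (+-assoc (2 + n + n) (toℕ v) 1) (cong (2 + n + n +_) (+-comm (toℕ v) 1))))
                            (offset-at (Fin.toℕ<n v)))
                     (offset-at (<⇒≤ (Fin.toℕ<n v))) ⟩
      offset f (suc (toℕ v)) ∸ offset f (toℕ v)
        ≡⟨ cong (_∸ offset f (toℕ v)) (offset-suc f v) ⟩
      offset f (toℕ v) + length (f v) ∸ offset f (toℕ v)
        ≡⟨ m+n∸m≡n (offset f (toℕ v)) _ ⟩
      length (f v)
        ≡⟨ length-map toℕ (neighbours L v) ⟩
      length (neighbours L v) ∎
  ; neighbour-at = λ v {x} x<l → begin
      m (2 + n + n + n + 1 + m (2 + n + n + toℕ v) + x)
        ≡⟨ cong m (trans (+-assoc (2 + n + n + n + 1) _ x)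
             (cong₂ (λ a b → a + (b + x)) (trans (+-assoc (2 + n + n) n 1) (cong (2 + n + n +_) (+-comm n 1)))
                                          (offset-at (<⇒≤ (Fin.toℕ<n v))))) ⟩
      m (2 + n + n + suc n + (offset f (toℕ v) + x))
        ≡⟨ cong m (+-assoc (2 + n + n) (suc n) _) ⟩
      m (2 + n + n + (suc n + (offset f (toℕ v) + x)))
        ≡⟨ afterJ _ ⟩
      cell (scanl _+_ 0 (map length (tabulate f)) ++ concat (tabulate f)) (suc n + (offset f (toℕ v) + x))
        ≡⟨ cell-++ʳ (scanl _+_ 0 (map length (tabulate f))) length-offsets _ ⟩
      cell (concat (tabulate f)) (offset f (toℕ v) + x)
        ≡⟨ cell-concat f v (subst (x <_) (sym (length-map toℕ (neighbours L v))) x<l) ⟩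
      cell (f v) x ∎
  }
  where
  open ≡-Reasoning
  m = cell (encode L I J u)
  f : Fin n → List ℕ
  f v = map toℕ (neighbours L v)
  graphPart = scanl _+_ 0 (map length (tabulate f)) ++ concat (tabulate f)
  length-lengths : length (map length (tabulate f)) ≡ n
  length-lengths = trans (length-map length (tabulate f)) (length-tabulate f)
  length-offsets : length (scanl _+_ 0 (map length (tabulate f))) ≡ suc n
  length-offsets = trans (length-scanl 0 (map length (tabulate f))) (cong suc length-lengths)
  afterI : ∀ i → m (2 + n + i) ≡ cell (characteristic J ++ graphPart) i
  afterI = cell-++ʳ (characteristic I) (length-characteristic I)
  afterJ : ∀ i → m (2 + n + n + i) ≡ cell graphPart i
  afterJ i = trans (cong m (+-assoc (2 + n) n i))
    (trans (afterI (n + i)) (cell-++ʳ (characteristic J) (length-characteristic J) i))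
  offset-at : ∀ {i} → i ≤ n → m (2 + n + n + i) ≡ offset f i
  offset-at {i} i≤n = trans (afterJ i) (trans
    (cell-++ˡ (scanl _+_ 0 (map length (tabulate f))) (subst (i <_) (sym length-offsets) (s≤s i≤n)))
    (cell-scanl 0 (map length (tabulate f)) (subst (i ≤_) (sym length-lengths) i≤n)))

-- Neighbour lists along a path

module _ {A : Set} where

  length-⊆-singleton : ∀ {a : A} {xs} → Unique xs → (∀ {x} → x ∈ˡ xs → x ≡ a) → length xs ≤ 1
  length-⊆-singleton {xs = []}         _ _ = z≤n
  length-⊆-singleton {xs = _ ∷ []}     _ _ = ≤-refl
  length-⊆-singleton {xs = _ ∷ _ ∷ _} ((x≢y All.∷ _) ∷ _) only =
    contradiction (trans (only (here refl)) (sym (only (there (here refl))))) x≢y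

  unique-singleton : ∀ {a : A} {xs} → Unique xs → a ∈ˡ xs → (∀ {x} → x ∈ˡ xs → x ≡ a) → xs ≡ a ∷ []
  unique-singleton {xs = _ ∷ []}    _ _ only = cong (_∷ []) (only (here refl))
  unique-singleton {xs = _ ∷ _ ∷ _} u _ only = contradiction (length-⊆-singleton u only) λ { (s≤s ()) }

  unique-pair-tail : ∀ {a b : A} {xs} → a ≢ b → Unique (a ∷ xs) → b ∈ˡ a ∷ xs →
                     (∀ {x} → x ∈ˡ a ∷ xs → x ≡ a ⊎ x ≡ b) → xs ≡ b ∷ []
  unique-pair-tail a≢b _ (here b≡a) _ = contradiction (sym b≡a) a≢b
  unique-pair-tail a≢b (a∉xs ∷ u) (there b∈xs) only = unique-singleton u b∈xs λ x∈xs →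
    case only (there x∈xs) of λ
      { (inj₁ refl) → contradiction refl (All.lookup a∉xs x∈xs)
      ; (inj₂ x≡b)  → x≡b }

  unique-pair : ∀ {a b : A} {xs} → a ≢ b → Unique xs → a ∈ˡ xs → b ∈ˡ xs →
                (∀ {x} → x ∈ˡ xs → x ≡ a ⊎ x ≡ b) → xs ≡ a ∷ b ∷ [] ⊎ xs ≡ b ∷ a ∷ []
  unique-pair {a} {b} {_ ∷ _} a≢b u a∈ b∈ only with only (here refl)
  ... | inj₁ refl = inj₁ (cong (a ∷_) (unique-pair-tail a≢b u b∈ only))
  ... | inj₂ refl = inj₂ (cong (b ∷_) (unique-pair-tail (a≢b ∘ sym) u a∈ (swap ∘ only)))

module Neighbours {n : ℕ} {G : Graph n} (T : Traversal G) (L : AdjacencyLists G) where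
  open Traversal T

  private
    around : ∀ {p w} → p < n → w ∈ˡ neighbours L (vertexAt p) →
             ∃ λ q → q < n × vertexAt q ≡ w × (q ≡ suc p ⊎ p ≡ suc q)
    around {w = w} p<n w∈ with exhaustive w
    ... | q , q<n , refl = q , q<n , refl , consecutive p<n q<n (Equivalence.to (correct L _ _) w∈)

    next∈ : ∀ {p} → suc p < n → vertexAt (suc p) ∈ˡ neighbours L (vertexAt p)
    next∈ 1+p<n = Equivalence.from (correct L _ _) (linked 1+p<n)

    prev∈ : ∀ {p} → suc p < n → vertexAt p ∈ˡ neighbours L (vertexAt (suc p))
    prev∈ 1+p<n = Equivalence.from (correct L _ _) (Graph.symmetric G (linked 1+p<n))

    only-next : 0 < n → ∀ {w} → w ∈ˡ neighbours L (vertexAt 0) → w ≡ vertexAt 1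
    only-next 0<n w∈ with around 0<n w∈
    ... | _ , _ , e , inj₁ refl = sym e

  -- An inequality, because the only vertex of a one-vertex path has degree 0; the machine tests for
  -- degree at most one for the same reason.
  degree-first : 0 < n → length (neighbours L (vertexAt 0)) ≤ 1
  degree-first 0<n = length-⊆-singleton (unique L _) (only-next 0<n)

  neighbours-first : 1 < n → neighbours L (vertexAt 0) ≡ vertexAt 1 ∷ []
  neighbours-first 1<n = unique-singleton (unique L _) (next∈ 1<n) (only-next (<-trans z<s 1<n))

  -- The listing order is unknown; the sum formed by the machine is the same for both.
  neighbours-inner : ∀ {p} → suc (suc p) < n → let a = vertexAt p ; b = vertexAt (suc (suc p)) in
    neighbours L (vertexAt (suc p)) ≡ a ∷ b ∷ [] ⊎ neighbours L (vertexAt (suc p)) ≡ b ∷ a ∷ []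
  neighbours-inner {p} 2+p<n = unique-pair
    (λ e → contradiction (distinct p<n 2+p<n e) (<⇒≢ (s≤s (n≤1+n p))))
    (unique L _) (prev∈ 1+p<n) (next∈ 2+p<n)
    λ w∈ → case around 1+p<n w∈ of λ
      { (_ , _ , e , inj₁ refl) → inj₂ (sym e)
      ; (_ , _ , e , inj₂ refl) → inj₁ (sym e) }
    where
    1+p<n = <-trans (n<1+n (suc p)) 2+p<n
    p<n = <-trans (n<1+n p) 1+p<n

  degree≤1⇒end : ∀ {p} → p < n → length (neighbours L (vertexAt p)) ≤ 1 → p ≡ 0 ⊎ suc p ≡ n
  degree≤1⇒end {zero}  _ _ = inj₁ refl
  degree≤1⇒end {suc p} 1+p<n d≤1 with m≤n⇒m<n∨m≡n 1+p<n
  ... | inj₂ e = inj₂ e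
  ... | inj₁ 2+p<n with neighbours-inner 2+p<n
  ...   | inj₁ e = contradiction (subst (λ xs → length xs ≤ 1) e d≤1) λ { (s≤s ()) }
  ...   | inj₂ e = contradiction (subst (λ xs → length xs ≤ 1) e d≤1) λ { (s≤s ()) }

-- A vertex of degree at most one is the first or the last, so the given order or its reverse starts
-- there.
traversal-from : ∀ {n} {G : Graph n} → Traversal G → (L : AdjacencyLists G) → ∀ v →
                 length (neighbours L v) ≤ 1 → Σ (Traversal G) λ T → Traversal.vertexAt T 0 ≡ v
traversal-from {n} T L v d≤1 with Traversal.exhaustive T v
... | p , p<n , refl with Neighbours.degree≤1⇒end T L p<n d≤1
...   | inj₁ refl = T , refl
...   | inj₂ refl = reverseTraversal T , refl

-- The machine

run-mono : ∀ prog {t t′ b} c → t ≤ t′ → run prog t c ≡ just b → run prog t′ c ≡ just b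
run-mono prog {suc t} {suc t′} c (s≤s t≤t′) e with nth prog (Config.pc c)
... | just i with execute i c
...   | inj₁ _  = e
...   | inj₂ c′ = run-mono prog c′ t≤t′ e

module Deciding (prog : Program) (m : ℕ → ℕ) (R : Set) where

  -- The memory is a fixed parameter because the program never stores. Runs are built backwards from
  -- `halt`, each lemma prepending instructions and their cost.
  record Decided (t p : ℕ) (ρ : ℕ → ℕ) : Set where
    constructor decided
    field
      answer   : Bool
      answered : run prog t (config p ρ m) ≡ just answer
      reflects : Reflects R answer

  weaken : ∀ {t t′ p ρ} → t ≤ t′ → Decided t p ρ → Decided t′ p ρ
  weaken t≤t′ (decided b e r) = decided b (run-mono prog _ t≤t′ e) r

  accept : ∀ {t p ρ} → nth prog p ≡ just (halt true) → R → Decided (suc t) p ρ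
  accept {t} {p} {ρ} i r = decided true step (ofʸ r)
    where
    step : run prog (suc t) (config p ρ m) ≡ just true
    step rewrite i = refl

  reject : ∀ {t p ρ} → nth prog p ≡ just (halt false) → ¬ R → Decided (suc t) p ρ
  reject {t} {p} {ρ} i ¬r = decided false step (ofⁿ ¬r)
    where
    step : run prog (suc t) (config p ρ m) ≡ just false
    step rewrite i = refl

  jump⁺ : ∀ {t p r q ρ} → nth prog p ≡ just (jumpIfPos r q) → 0 < ρ r →
          Decided t q ρ → Decided (suc t) p ρ
  jump⁺ {t} {p} {r} {q} {ρ} i ρr>0 (decided b e d) = decided b step d
    where
    step : run prog (suc t) (config p ρ m) ≡ just b
    step rewrite i with suc _ ← ρ r = e

  jump⁰ : ∀ {t p r q ρ} → nth prog p ≡ just (jumpIfPos r q) → ρ r ≡ 0 →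
          Decided t (suc p) ρ → Decided (suc t) p ρ
  jump⁰ {t} {p} {r} {q} {ρ} i ρr≡0 (decided b e d) = decided b step d
    where
    step : run prog (suc t) (config p ρ m) ≡ just b
    step rewrite i | ρr≡0 = e

  branch : ∀ {t p r q ρ} → nth prog p ≡ just (jumpIfPos r q) →
           (0 < ρ r → Decided t q ρ) → (ρ r ≡ 0 → Decided t (suc p) ρ) → Decided (suc t) p ρ
  branch {r = r} {ρ = ρ} i pos zer with ρ r in e
  ... | zero  = jump⁰ i e (zer refl)
  ... | suc _ = jump⁺ i (subst (0 <_) (sym e) z<s) (pos z<s)

  straight : Maybe Instruction → Bool
  straight (just (const _ _)) = true
  straight (just (add _ _ _)) = true
  straight (just (sub _ _ _)) = true
  straight (just (load _ _))  = true
  straight _                  = false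

  effect : Maybe Instruction → (ℕ → ℕ) → (ℕ → ℕ)
  effect (just (const r c)) ρ = ρ [ r ↦ c ]
  effect (just (add r s t)) ρ = ρ [ r ↦ ρ s + ρ t ]
  effect (just (sub r s t)) ρ = ρ [ r ↦ ρ s ∸ ρ t ]
  effect (just (load r s))  ρ = ρ [ r ↦ m (ρ s) ]
  effect _                  ρ = ρ

  Straight : ℕ → ℕ → Set
  Straight zero    p = ⊤
  Straight (suc s) p = T (straight (nth prog p)) × Straight s (suc p)

  counterAfter : ℕ → ℕ → ℕ
  counterAfter zero    p = p
  counterAfter (suc s) p = counterAfter s (suc p)

  registersAfter : ℕ → ℕ → (ℕ → ℕ) → (ℕ → ℕ)
  registersAfter zero    p ρ = ρ
  registersAfter (suc s) p ρ = registersAfter s (suc p) (effect (nth prog p) ρ)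

  step-straight : ∀ {t} p ρ → T (straight (nth prog p)) →
                  run prog (suc t) (config p ρ m) ≡ run prog t (config (suc p) (effect (nth prog p) ρ) m)
  step-straight p ρ s with nth prog p
  ... | just (const _ _) = refl
  ... | just (add _ _ _) = refl
  ... | just (sub _ _ _) = refl
  ... | just (load _ _)  = refl

  -- Symbolic execution by normalisation: for literal `s` and `p`, `Straight s p` computes to a
  -- product of unit types and is inferred, and reading a literal register of `registersAfter`
  -- computes as well.
  steps : ∀ s {t p ρ} {_ : Straight s p} →
          Decided t (counterAfter s p) (registersAfter s p ρ) → Decided (s + t) p ρ
  steps zero                 d = d
  steps (suc s) {_} {p} {ρ} {i , is} d with steps s {p = suc p} {_} {is} d
  ... | decided b e r = decided b (trans (step-straight p ρ i) e) r

decided⇒decides : ∀ prog input R {t} → Deciding.Decided prog (cell input) R t 0 (λ _ → 0) →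
                  prog on input decides R within t
decided⇒decides prog input R (Deciding.decided b e r) = b , e , r

-- Constant registers: 0 and 1 hold 0 and 1, 2 and 3 hold n and u, 4 to 7 the addresses of I,
-- of J, of the offsets and of the concatenated lists, 8 holds k.
program : ℕ → Program
program k =
  -- 0
  const 1 1 ∷ load 2 0 ∷ load 3 1 ∷ const 4 2 ∷ add 5 4 2 ∷ add 6 5 2 ∷
  add 7 6 2 ∷ add 7 7 1 ∷ const 8 k ∷
  -- 9: for each vertex (register 9), update ∣ I ∣ (11), ∣ J ∣ (12) and the number of
  -- differences (13), and store the vertex in register 10 if its degree is at most one
  add 14 4 9 ∷ load 14 14 ∷ add 11 11 14 ∷
  add 15 5 9 ∷ load 15 15 ∷ add 12 12 15 ∷
  sub 16 14 15 ∷ add 13 13 16 ∷ sub 16 15 14 ∷ add 13 13 16 ∷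
  add 17 6 9 ∷ add 16 17 1 ∷ load 16 16 ∷ load 17 17 ∷ sub 16 16 17 ∷ sub 16 16 1 ∷
  jumpIfPos 16 27 ∷ add 10 9 0 ∷
  add 9 9 1 ∷ sub 16 2 9 ∷ jumpIfPos 16 9 ∷
  -- 30: the immediate answers; otherwise test I first
  sub 16 11 3 ∷ jumpIfPos 16 71 ∷ sub 16 12 3 ∷ jumpIfPos 16 71 ∷
  jumpIfPos 13 36 ∷ halt true ∷
  add 18 4 0 ∷ add 19 11 0 ∷
  -- 38: test the set at address (18), of size (19)
  sub 16 3 19 ∷ jumpIfPos 16 72 ∷
  add 21 10 0 ∷ add 16 6 21 ∷ load 16 16 ∷ add 16 7 16 ∷ load 22 16 ∷
  const 9 0 ∷ const 23 0 ∷ const 24 0 ∷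
  -- 48: walk along the path; the vertex at position (9) is (21) and the next one is (22),
  -- and (23) and (24) are the a and e of Scanned
  add 16 18 21 ∷ load 16 16 ∷ jumpIfPos 16 52 ∷ jumpIfPos 1 56 ∷
  -- Reached at marked vertices only. The previous mark has now found its right boundary and is
  -- tested before (23) and (24) are updated.
  sub 16 24 9 ∷ jumpIfPos 16 72 ∷ add 24 23 8 ∷ add 23 9 1 ∷
  -- 56: the vertex after (22) is the sum of its two neighbours minus (21)
  add 16 6 22 ∷ load 16 16 ∷ add 17 7 16 ∷ load 16 17 ∷ add 17 17 1 ∷ load 17 17 ∷
  add 16 16 17 ∷ sub 16 16 21 ∷ add 21 22 0 ∷ add 22 16 0 ∷
  add 9 9 1 ∷ sub 16 2 9 ∷ jumpIfPos 16 48 ∷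
  -- The end of the path is the right boundary of the last mark.
  sub 16 24 9 ∷ jumpIfPos 16 72 ∷
  -- 71: a tight set without redundant vertex
  halt false ∷
  -- 72: the test has succeeded; register 20 tells whether J has been tested
  jumpIfPos 20 77 ∷ const 20 1 ∷ add 18 5 0 ∷ add 19 12 0 ∷ jumpIfPos 1 38 ∷
  halt true ∷ []

-- Partial counts and comparison of the two sets

prefix : ∀ {n} → Subset n → ℕ → ℕ
prefix A i = sum (take i (characteristic A))

prefix-suc : ∀ {n} (A : Subset n) v → prefix A (suc (toℕ v)) ≡ prefix A (toℕ v) + bit (lookup A v)
prefix-suc (b ∷ A) Fin.zero    = +-identityʳ (bit b)
prefix-suc (b ∷ A) (Fin.suc v) =
  trans (cong (bit b +_) (prefix-suc A v)) (sym (+-assoc (bit b) (prefix A (toℕ v)) _))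

prefix-all : ∀ {n} (A : Subset n) → prefix A n ≡ ∣ A ∣
prefix-all []          = refl
prefix-all (true ∷ A)  = cong suc (prefix-all A)
prefix-all (false ∷ A) = prefix-all A

<-suc-cases : ∀ {n} {w v : Fin n} → toℕ w < suc (toℕ v) → toℕ w < toℕ v ⊎ w ≡ v
<-suc-cases w≤v with m<1+n⇒m<n∨m≡n w≤v
... | inj₁ w<v = inj₁ w<v
... | inj₂ w≡v = inj₂ (Fin.toℕ-injective w≡v)

-- Of the number of differences only its vanishing matters.
record Compared {n} (I J : Subset n) (i d : ℕ) : Set where
  field
    agree   : d ≡ 0 → ∀ {v} → toℕ v < i → lookup I v ≡ lookup J v
    differ : 0 < d → I ≢ J

-- At most one of the two truncated differences is positive; together they add 1 exactly when the
-- bits differ.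
compared-suc : ∀ {n} {I J : Subset n} {v d x y} → x ≡ bit (lookup I v) → y ≡ bit (lookup J v) →
               Compared I J (toℕ v) d → Compared I J (suc (toℕ v)) (d + (x ∸ y) + (y ∸ x))
compared-suc {I = I} {J} {v} {d} refl refl c with lookup I v in eᵢ | lookup J v in eⱼ
... | true | true rewrite +-identityʳ d | +-identityʳ d = record
  { agree = λ d≡0 w≤v → case <-suc-cases w≤v of λ
      { (inj₁ w<v) → Compared.agree c d≡0 w<v ; (inj₂ refl) → trans eᵢ (sym eⱼ) }
  ; differ = Compared.differ c }
... | false | false rewrite +-identityʳ d | +-identityʳ d = record
  { agree = λ d≡0 w≤v → case <-suc-cases w≤v of λ
      { (inj₁ w<v) → Compared.agree c d≡0 w<v ; (inj₂ refl) → trans eᵢ (sym eⱼ) }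
  ; differ = Compared.differ c }
... | true | false rewrite +-identityʳ (d + 1) = record
  { agree = λ d+1≡0 → contradiction d+1≡0 (m+1+n≢0 d)
  ; differ = λ { _ refl → contradiction (trans (sym eᵢ) eⱼ) λ () } }
... | false | true rewrite +-identityʳ d = record
  { agree = λ d+1≡0 → contradiction d+1≡0 (m+1+n≢0 d)
  ; differ = λ { _ refl → contradiction (trans (sym eᵢ) eⱼ) λ () } }

-- Correctness and running time of the machine

module Correctness
  {n′ : ℕ} (k : ℕ) .{{_ : NonZero k}} {P : Graph (suc n′)} (T₀ : Traversal P) (L : AdjacencyLists P)
  (I J : Subset (suc n′)) (coverI : IsPathVertexCover k P I) (coverJ : IsPathVertexCover k P J) (u : ℕ)
  (m : ℕ → ℕ) (rep : Represents L I J u m) where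

  open Represents rep

  n : ℕ
  n = suc n′

  open Deciding (program k) m (Reconfigurable k P u I J)

  degree : Fin n → ℕ
  degree v = length (neighbours L v)

  Constants : (ℕ → ℕ) → Set
  Constants ρ = ρ 0 ≡ 0 × ρ 1 ≡ 1 × ρ 2 ≡ n × ρ 3 ≡ u × ρ 4 ≡ 2 × ρ 5 ≡ 2 + n ×
                ρ 6 ≡ 2 + n + n × ρ 7 ≡ 2 + n + n + n + 1 × ρ 8 ≡ k

  -- Register 10 means nothing until an end has been met, whence the second alternative. Of several
  -- ends the latest is kept; any of them will do.
  Located : ℕ → ℕ → Set
  Located i s = (∃ λ v → s ≡ toℕ v × degree v ≤ 1) ⊎ (∀ {v} → toℕ v < i → 1 < degree v)

  -- The rest of the run enters as a continuation of cost `T`, so that the costs of the phases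
  -- simply add up.
  module Survey (T : ℕ)
    (continue : ∀ {ρ} → Constants ρ → ρ 20 ≡ 0 → ρ 11 ≡ ∣ I ∣ → ρ 12 ≡ ∣ J ∣ →
                Compared I J n (ρ 13) → Located n (ρ 10) → Decided T 30 ρ) where

    -- The cost 21 per vertex consists of 16 straight instructions, the jump on the degree, the
    -- recording of an end, and 3 instructions of loop control.
    survey : ∀ rem {i ρ} → i + suc rem ≡ n → Constants ρ → ρ 20 ≡ 0 → ρ 9 ≡ i →
             ρ 11 ≡ prefix I i → ρ 12 ≡ prefix J i → Compared I J i (ρ 13) → Located i (ρ 10) →
             Decided (suc rem * 21 + T) 9 ρ

    survey-at : ∀ rem {i ρ} v → toℕ v ≡ i → i + suc rem ≡ n → Constants ρ → ρ 20 ≡ 0 → ρ 9 ≡ i →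
             ρ 11 ≡ prefix I i → ρ 12 ≡ prefix J i → Compared I J i (ρ 13) → Located i (ρ 10) →
             Decided (suc rem * 21 + T) 9 ρ

    survey-next : ∀ rem {i ρ} → i + suc rem ≡ n → Constants ρ → ρ 20 ≡ 0 → ρ 9 ≡ i →
             ρ 11 ≡ prefix I (suc i) → ρ 12 ≡ prefix J (suc i) →
             Compared I J (suc i) (ρ 13) → Located (suc i) (ρ 10) →
             Decided (3 + (rem * 21 + T)) 27 ρ
    survey-next zero {i} {ρ} i+1≡n c@(_ , r1 , r2 , _) r20 r9 r11 r12 compared located =
      steps 2 (jump⁰ refl (trans (cong₂ _∸_ r2 ρ9′) (n∸n≡0 n))
        (continue c r20 (trans r11 (trans (cong (prefix I) 1+i≡n) (prefix-all I)))
          (trans r12 (trans (cong (prefix J) 1+i≡n) (prefix-all J)))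
          (subst (λ i → Compared I J i (ρ 13)) 1+i≡n compared)
          (subst (λ i → Located i (ρ 10)) 1+i≡n located)))
      where
      1+i≡n : suc i ≡ n
      1+i≡n = trans (+-comm 1 i) i+1≡n
      ρ9′ : ρ 9 + ρ 1 ≡ n
      ρ9′ = trans (cong₂ _+_ r9 r1) i+1≡n
    survey-next (suc rem) {i} {ρ} e c@(_ , r1 , r2 , _) r20 r9 r11 r12 compared located =
      steps 2 (jump⁺ refl (subst (0 <_) (sym (cong₂ _∸_ r2 ρ9′)) (m<n⇒0<n∸m 1+i<n))
        (survey rem e′ c r20 ρ9′ r11 r12 compared located))
      where
      e′ : suc i + suc rem ≡ n
      e′ = trans (sym (+-suc i (suc rem))) e
      1+i<n : suc i < n
      1+i<n = subst (suc i <_) e′ (m<m+n (suc i) z<s)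
      ρ9′ : ρ 9 + ρ 1 ≡ suc i
      ρ9′ = trans (cong₂ _+_ r9 r1) (+-comm i 1)

    survey rem {i} e c r20 r9 = survey-at rem (fromℕ< i<n) (Fin.toℕ-fromℕ< i<n) e c r20 r9
      where
      i<n : i < n
      i<n = subst (i <_) e (m<m+n i z<s)

    survey-at rem {ρ = ρ} v refl e c@(r0 , r1 , r2 , r3 , r4 , r5 , r6 , r7 , r8) r20 r9 r11 r12 compared located =
      steps 16 (branch refl
        -- Skipping the recording saves one instruction.
        (λ d>1 → weaken (n≤1+n _) (survey-next rem e c r20 r9 r11′ r12′ compared′
          (still-located (subst (0 <_) ρ16 d>1) located)))
        (λ d≤1 → steps 1 (survey-next rem e c r20 r9 r11′ r12′ compared′
          (found (trans (sym ρ16) d≤1)))))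
      where
      bitI : m (ρ 4 + ρ 9) ≡ bit (lookup I v)
      bitI = trans (cong m (cong₂ _+_ r4 r9)) (I-at v)
      bitJ : m (ρ 5 + ρ 9) ≡ bit (lookup J v)
      bitJ = trans (cong m (cong₂ _+_ r5 r9)) (J-at v)
      r11′ : ρ 11 + m (ρ 4 + ρ 9) ≡ prefix I (suc (toℕ v))
      r11′ = trans (cong₂ _+_ r11 bitI) (sym (prefix-suc I v))
      r12′ : ρ 12 + m (ρ 5 + ρ 9) ≡ prefix J (suc (toℕ v))
      r12′ = trans (cong₂ _+_ r12 bitJ) (sym (prefix-suc J v))
      compared′ = compared-suc bitI bitJ compared
      ρ16 : m (ρ 6 + ρ 9 + ρ 1) ∸ m (ρ 6 + ρ 9) ∸ ρ 1 ≡ degree v ∸ 1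
      ρ16 = cong₂ _∸_ (trans (cong₂ _∸_ (cong m (cong₂ _+_ (cong₂ _+_ r6 r9) r1)) (cong m (cong₂ _+_ r6 r9)))
        (degree-at v)) r1
      still-located : 0 < degree v ∸ 1 → Located (toℕ v) (ρ 10) → Located (suc (toℕ v)) (ρ 10)
      still-located d>1 (inj₁ f) = inj₁ f
      still-located d>1 (inj₂ none)  = inj₂ λ w≤v → case <-suc-cases w≤v of λ
        { (inj₁ w<v) → none w<v ; (inj₂ refl) → m∸n≢0⇒n<m (>⇒≢ d>1) }
      found : degree v ∸ 1 ≡ 0 → Located (suc (toℕ v)) (ρ 9 + ρ 0)
      found d≤1 = inj₁ (v , trans (cong₂ _+_ r9 r0) (+-identityʳ (toℕ v)) , m∸n≡0⇒m≤n d≤1)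

  module Testing (T : Traversal P) where
    open Traversal T
    open Ordered T k
    open Neighbours T L

    neighbours-at : ∀ v {ρ7 ρ6 w} → ρ7 ≡ 2 + n + n + n + 1 → ρ6 ≡ 2 + n + n → w ≡ toℕ v →
                    ∀ {x} → x < degree v → m (ρ7 + m (ρ6 + w) + x) ≡ cell (map toℕ (neighbours L v)) x
    neighbours-at v refl refl refl = neighbour-at v

    second-vertex : ∀ {ρ7 ρ6 w} → ρ7 ≡ 2 + n + n + n + 1 → ρ6 ≡ 2 + n + n → w ≡ toℕ (vertexAt 0) →
                    1 < n → m (ρ7 + m (ρ6 + w)) ≡ toℕ (vertexAt 1)
    second-vertex {ρ7} {ρ6} {w} r7 r6 e 1<n = begin
      m (ρ7 + m (ρ6 + w))     ≡⟨ cong m (+-identityʳ (ρ7 + m (ρ6 + w))) ⟨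
      m (ρ7 + m (ρ6 + w) + 0) ≡⟨ neighbours-at (vertexAt 0) r7 r6 e
                                   (subst (λ xs → 0 < length xs) (sym (neighbours-first 1<n)) z<s) ⟩
      cell (map toℕ (neighbours L (vertexAt 0))) 0
                              ≡⟨ cong (λ xs → cell (map toℕ xs) 0) (neighbours-first 1<n) ⟩
      toℕ (vertexAt 1)        ∎
      where open ≡-Reasoning

    following-vertex : ∀ {ρ7 ρ6 v w i o} → ρ7 ≡ 2 + n + n + n + 1 → ρ6 ≡ 2 + n + n → o ≡ 1 →
      v ≡ toℕ (vertexAt i) → w ≡ toℕ (vertexAt (suc i)) → suc (suc i) < n →
      m (ρ7 + m (ρ6 + w)) + m (ρ7 + m (ρ6 + w) + o) ∸ v ≡ toℕ (vertexAt (suc (suc i)))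
    following-vertex {ρ7} {ρ6} {v} {w} {i} r7 r6 refl refl e 2+i<n = trans
      (cong (_∸ toℕ (vertexAt i)) (cong₂ _+_
        (trans (cong m (sym (+-identityʳ (ρ7 + m (ρ6 + w))))) (at 0 (s≤s z≤n)))
        (at 1 ≤-refl)))
      (sum-minus (neighbours-inner 2+i<n))
      where
      ns = neighbours L (vertexAt (suc i))
      two : length ns ≡ 2
      two with neighbours-inner 2+i<n
      ... | inj₁ e = cong length e
      ... | inj₂ e = cong length e
      at : ∀ x → x < 2 → m (ρ7 + m (ρ6 + w) + x) ≡ cell (map toℕ ns) x
      at x x<2 = neighbours-at (vertexAt (suc i)) r7 r6 e (subst (x <_) (sym two) x<2)
      sum-minus : ∀ {xs a b} → xs ≡ a ∷ b ∷ [] ⊎ xs ≡ b ∷ a ∷ [] →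
                  cell (map toℕ xs) 0 + cell (map toℕ xs) 1 ∸ toℕ {n} a ≡ toℕ {n} b
      sum-minus {a = a} {b} (inj₁ refl) = m+n∸m≡n (toℕ a) (toℕ b)
      sum-minus {a = a} {b} (inj₂ refl) = m+n∸n≡m (toℕ b) (toℕ a)

    -- The flag `f` plays the part of a return address: it is 0 while I is tested and 1 while J is.
    Stable : ℕ → (ℕ → ℕ) → Set
    Stable f ρ = Constants ρ × ρ 10 ≡ toℕ (vertexAt 0) × ρ 11 ≡ ∣ I ∣ × ρ 12 ≡ ∣ J ∣ × ρ 20 ≡ f

    -- Both tests execute the same code, so the set, its address and the continuation after success
    -- are parameters.
    module Test (K : Subset n) (denseK : Dense K) (D : ℕ) (D-at : ∀ v → m (D + toℕ v) ≡ bit (lookup K v))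
      (f t : ℕ)
      (pass : ∣ K ∣ < u ⊎ Removable K → ∀ {ρ} → Stable f ρ → Decided t 72 ρ)
      (fail : u ≤ ∣ K ∣ → Irredundant K → ¬ Reconfigurable k P u I J) where

      record AtPosition (i : ℕ) (ρ : ℕ → ℕ) : Set where
        constructor at
        field
          stable  : Stable f ρ
          address : ρ 18 ≡ D
          index   : ρ 9 ≡ i
          current : ρ 21 ≡ toℕ (vertexAt i)
          -- The machine computes a successor even where there is none; register 22 then holds an
          -- arbitrary number.
          next    : suc i < n → ρ 22 ≡ toℕ (vertexAt (suc i))

      spare : ∀ a b → t ≤ a + (b + (3 + t))
      spare a b = m≤n⇒m≤o+n a (m≤n⇒m≤o+n b (m≤n+m t 3))

      module _ (tight : u ≤ ∣ K ∣) where

        -- The cost 20 per position is at most 7 for inspecting the vertex and 13 for moving on; the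
        -- final 3 are the test at the end of the path and a possible `halt`.
        walk : ∀ rem {i ρ} → i + suc rem ≡ n → AtPosition i ρ → Scanned K i (ρ 23) (ρ 24) →
               Decided (suc rem * 20 + (3 + t)) 48 ρ

        advance : ∀ rem {i ρ} → i + suc rem ≡ n → AtPosition i ρ → Scanned K (suc i) (ρ 23) (ρ 24) →
                  Decided (13 + (rem * 20 + (3 + t))) 56 ρ
        advance rem {i} {ρ} e (at s@((r0 , r1 , r2 , r3 , r4 , r5 , r6 , r7 , r8) , _) r18 r9 r21 r22) scanned =
          steps 12 (continue rem e)
          where
          ρ′ = registersAfter 12 56 ρ
          ρ9′ : ρ 9 + ρ 1 ≡ suc i
          ρ9′ = trans (cong₂ _+_ r9 r1) (+-comm i 1)
          ρ21′ : suc i < n → ρ 22 + ρ 0 ≡ toℕ (vertexAt (suc i))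
          ρ21′ 1+i<n = trans (cong₂ _+_ (r22 1+i<n) r0) (+-identityʳ (toℕ (vertexAt (suc i))))
          ρ22′ : suc (suc i) < n →
                 (m (ρ 7 + m (ρ 6 + ρ 22)) + m (ρ 7 + m (ρ 6 + ρ 22) + ρ 1) ∸ ρ 21) + ρ 0
                   ≡ toℕ (vertexAt (suc (suc i)))
          ρ22′ 2+i<n = trans
            (cong₂ _+_ (following-vertex r7 r6 r1 r21 (r22 (<-trans (n<1+n (suc i)) 2+i<n)) 2+i<n) r0)
            (+-identityʳ (toℕ (vertexAt (suc (suc i)))))
          -- The case split comes after the 12 straight instructions, which are thus executed once
          -- for both cases.
          continue : ∀ rem → i + suc rem ≡ n → Decided (1 + (rem * 20 + (3 + t))) 68 ρ′
          continue zero e = jump⁰ refl ρ16 (steps 1 (branch refl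
            (λ e>n → weaken (n≤1+n t)
              (pass (inj₂ (scan-removable scannedₙ ≤-refl (inj₁ refl) (subst (0 <_) ρ16′ e>n) denseK)) s))
            (λ e≤n → reject refl (fail tight (scan-irredundant scannedₙ ≤-refl (trans (sym ρ16′) e≤n))))))
            where
            1+i≡n : suc i ≡ n
            1+i≡n = trans (+-comm 1 i) e
            scannedₙ : Scanned K n (ρ 23) (ρ 24)
            scannedₙ = subst (λ i → Scanned K i (ρ 23) (ρ 24)) 1+i≡n scanned
            ρ16 : ρ 2 ∸ (ρ 9 + ρ 1) ≡ 0
            ρ16 = trans (cong₂ _∸_ r2 (trans ρ9′ 1+i≡n)) (n∸n≡0 n)
            ρ16′ : ρ 24 ∸ (ρ 9 + ρ 1) ≡ ρ 24 ∸ n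
            ρ16′ = cong (ρ 24 ∸_) (trans ρ9′ 1+i≡n)
          continue (suc rem) e = jump⁺ refl ρ16 (walk rem e′ (at s r18 ρ9′ (ρ21′ 1+i<n) ρ22′) scanned)
            where
            e′ : suc i + suc rem ≡ n
            e′ = trans (sym (+-suc i (suc rem))) e
            1+i<n : suc i < n
            1+i<n = subst (suc i <_) e′ (m<m+n (suc i) z<s)
            ρ16 : 0 < ρ 2 ∸ (ρ 9 + ρ 1)
            ρ16 = subst (0 <_) (sym (cong₂ _∸_ r2 ρ9′)) (m<n⇒0<n∸m 1+i<n)

        walk rem {i} {ρ} e pos@(at s@((r0 , r1 , r2 , r3 , r4 , r5 , r6 , r7 , r8) , _) r18 r9 r21 r22) scanned =
          steps 2 (branch refl
            (λ marked → steps 1 (branch refl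
              (λ e>i → weaken (spare 15 (rem * 20)) (pass (removable (i∈K marked) e>i) s))
              (λ e≤i → steps 2 (advance rem e (at s r18 r9 r21 r22) (scanned′ (i∈K marked) e≤i)))))
            -- An unmarked vertex takes three instructions fewer.
            (λ unmarked → jump⁺ refl (subst (0 <_) (sym r1) z<s) (weaken (m≤n+m _ 3)
              (advance rem e (at s r18 r9 r21 r22) (scan-unmarked scanned (i∉K unmarked))))))
          where
          i<n : i < n
          i<n = subst (i <_) e (m<m+n i z<s)
          marking : m (ρ 18 + ρ 21) ≡ bit (mark K i)
          marking = trans (cong m (cong₂ _+_ r18 r21)) (D-at (vertexAt i))
          i∈K : 0 < m (ρ 18 + ρ 21) → mark K i ≡ true
          i∈K marked with mark K i | subst (0 <_) marking marked
          ... | true | _ = refl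
          i∉K : m (ρ 18 + ρ 21) ≡ 0 → mark K i ≡ false
          i∉K unmarked with mark K i | trans (sym marking) unmarked
          ... | false | _ = refl
          removable : mark K i ≡ true → 0 < ρ 24 ∸ ρ 9 → ∣ K ∣ < u ⊎ Removable K
          removable i∈K e>i = inj₂ (scan-removable scanned (<⇒≤ i<n) (inj₂ i∈K)
            (subst (λ j → 0 < ρ 24 ∸ j) r9 e>i) denseK)
          scanned′ : mark K i ≡ true → ρ 24 ∸ ρ 9 ≡ 0 → Scanned K (suc i) (ρ 9 + ρ 1) (ρ 23 + ρ 8)
          scanned′ i∈K e≤i = subst₂ (Scanned K (suc i)) (sym (trans (cong₂ _+_ r9 r1) (+-comm i 1)))
            (cong (ρ 23 +_) (sym r8))
            (scan-marked scanned i<n i∈K (subst (λ j → ρ 24 ∸ j ≡ 0) r9 e≤i))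

      test : ∀ {ρ} → Stable f ρ → ρ 18 ≡ D → ρ 19 ≡ ∣ K ∣ → Decided (10 + (n * 20 + (3 + t))) 38 ρ
      test {ρ} s@((r0 , r1 , r2 , r3 , r4 , r5 , r6 , r7 , r8) , r10 , _) r18 r19 =
        steps 1 (branch refl
          (λ K<u → weaken (spare 8 (n * 20)) (pass (inj₁ (m∸n≢0⇒n<m (>⇒≢ (subst (0 <_) ρ16 K<u)))) s))
          (λ K≥u → steps 8 (walk (m∸n≡0⇒m≤n (trans (sym ρ16) K≥u)) n′ refl
            (at s r18 refl ρ21 ρ22) scan-start)))
        where
        ρ16 : ρ 3 ∸ ρ 19 ≡ u ∸ ∣ K ∣
        ρ16 = cong₂ _∸_ r3 r19
        ρ21 : ρ 10 + ρ 0 ≡ toℕ (vertexAt 0)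
        ρ21 = trans (cong₂ _+_ r10 r0) (+-identityʳ (toℕ (vertexAt 0)))
        ρ22 : 1 < n → m (ρ 7 + m (ρ 6 + (ρ 10 + ρ 0))) ≡ toℕ (vertexAt 1)
        ρ22 = second-vertex r7 r6 ρ21

    denseI : Dense I
    denseI = cover⇒dense coverI

    denseJ : Dense J
    denseJ = cover⇒dense coverJ

    module _ (I≤u : ∣ I ∣ ≤ u) (J≤u : ∣ J ∣ ≤ u) (I≢J : I ≢ J) where

      fail-I : u ≤ ∣ I ∣ → Irredundant I → ¬ Reconfigurable k P u I J
      fail-I tight irr s = I≢J (Moves.tight-isolated u tight irr (proj₂ (fromTAR s)))

      fail-J : u ≤ ∣ J ∣ → Irredundant J → ¬ Reconfigurable k P u I J
      fail-J tight irr s = I≢J (sym (Moves.tight-isolated u tight irr (reverse Move-sym (proj₂ (fromTAR s)))))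

      test-J : ∣ I ∣ < u ⊎ Removable I → ∀ {ρ} → Stable 1 ρ → ρ 18 ≡ 2 + n → ρ 19 ≡ ∣ J ∣ →
               Decided (10 + (n * 20 + (3 + 2))) 38 ρ
      test-J movableI = Test.test J denseJ (2 + n) J-at 1 2
        (λ movableJ {ρ} (_ , _ , _ , _ , r20) → jump⁺ refl (subst (0 <_) (sym r20) z<s)
          (accept refl (toTAR (coverI , I≤u)
            (Moves.slack-or-removable-connected u denseI I≤u denseJ J≤u movableI movableJ))))
        fail-J

      test-I : ∀ {ρ} → Stable 0 ρ → ρ 18 ≡ 2 → ρ 19 ≡ ∣ I ∣ →
               Decided (10 + (n * 20 + (3 + (5 + (10 + (n * 20 + (3 + 2))))))) 38 ρ
      test-I = Test.test I denseI 2 I-at 0 _ next fail-I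
        where
        next : ∣ I ∣ < u ⊎ Removable I → ∀ {ρ} → Stable 0 ρ → Decided (5 + (10 + (n * 20 + (3 + 2)))) 72 ρ
        next movableI {ρ} (c@(r0 , r1 , _ , _ , _ , r5 , _) , r10 , r11 , r12 , r20) =
          jump⁰ refl r20 (steps 3 (jump⁺ refl (subst (0 <_) (sym r1) z<s)
            (test-J movableI (c , r10 , r11 , r12 , refl) ρ18 ρ19)))
          where
          ρ18 : ρ 5 + ρ 0 ≡ 2 + n
          ρ18 = trans (cong₂ _+_ r5 r0) (+-identityʳ (2 + n))
          ρ19 : ρ 12 + ρ 0 ≡ ∣ J ∣
          ρ19 = trans (cong₂ _+_ r12 r0) (+-identityʳ ∣ J ∣)

  -- Each test costs 10 to set up, 20 per vertex and 3 at the end; 5 switch from I to J, and 2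
  -- accept.
  time : ℕ
  time = 10 + (n * 20 + (3 + (5 + (10 + (n * 20 + (3 + 2))))))

  verdict : ∀ {ρ} → Constants ρ → ρ 20 ≡ 0 → ρ 11 ≡ ∣ I ∣ → ρ 12 ≡ ∣ J ∣ →
            Compared I J n (ρ 13) → Located n (ρ 10) → Decided (7 + time) 30 ρ
  -- Some end has been found, as the first vertex of any traversal has degree at most one.
  verdict _ _ _ _ _ (inj₂ none) = contradiction (Neighbours.degree-first T₀ L z<s)
    (<⇒≱ (none (Fin.toℕ<n (Traversal.vertexAt T₀ 0))))
  verdict {ρ} c@(r0 , _ , _ , r3 , r4 , _) r20 r11 r12 compared (inj₁ (v , r10 , d≤1)) =
    steps 1 (branch refl
      (λ I>u → reject refl (λ s → <⇒≱ (above ρ16 I>u) (proj₂ (proj₁ (fromTAR s)))))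
      (λ I≤u → steps 1 (branch refl
        (λ J>u → reject refl (λ s → <⇒≱ (above ρ16′ J>u) (proj₂ (end-feasible s))))
        (λ J≤u → branch refl
          (λ d>0 → steps 2 (testing (within ρ16 I≤u) (within ρ16′ J≤u) (Compared.differ compared d>0)))
          (λ d≡0 → accept refl (toTAR (coverI , within ρ16 I≤u) (subst (Star (Move k P u) I) (same d≡0) ε)))))))
    where
    ρ16 : ρ 11 ∸ ρ 3 ≡ ∣ I ∣ ∸ u
    ρ16 = cong₂ _∸_ r11 r3
    ρ16′ : ρ 12 ∸ ρ 3 ≡ ∣ J ∣ ∸ u
    ρ16′ = cong₂ _∸_ r12 r3
    above : ∀ {d a} → d ≡ a ∸ u → 0 < d → u < a
    above refl d>0 = m∸n≢0⇒n<m (>⇒≢ d>0)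
    within : ∀ {d a} → d ≡ a ∸ u → d ≡ 0 → a ≤ u
    within refl d≡0 = m∸n≡0⇒m≤n d≡0
    end-feasible : Reconfigurable k P u I J → Feasible k P u J
    end-feasible s = subst (Feasible k P u) end (cover (fromℕ ℓ) , bounded (fromℕ ℓ))
      where open TARSequence s
    same : ρ 13 ≡ 0 → I ≡ J
    same d≡0 = lookup-injective I J λ v → Compared.agree compared d≡0 (Fin.toℕ<n v)
    testing : ∣ I ∣ ≤ u → ∣ J ∣ ≤ u → I ≢ J →
              Decided time 38 ((ρ [ 16 ↦ ρ 11 ∸ ρ 3 ]) [ 16 ↦ ρ 12 ∸ ρ 3 ] [ 18 ↦ ρ 4 + ρ 0 ] [ 19 ↦ ρ 11 + ρ 0 ])
    -- Only here is the direction of the path fixed, by the end in register 10.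
    testing I≤u J≤u I≢J with traversal-from T₀ L v d≤1
    ... | T , v≡ = Testing.test-I T I≤u J≤u I≢J
      (c , trans r10 (cong toℕ (sym v≡)) , r11 , r12 , r20) ρ18 ρ19
      where
      ρ18 : ρ 4 + ρ 0 ≡ 2
      ρ18 = cong₂ _+_ r4 r0
      ρ19 : ρ 11 + ρ 0 ≡ ∣ I ∣
      ρ19 = trans (cong₂ _+_ r11 r0) (+-identityʳ ∣ I ∣)

  -- The left side is 61 n + 49, and 49 is at most 49 n since the path is nonempty.
  time-linear : 9 + (n * 21 + (7 + time)) ≤ 110 * n
  time-linear = subst (9 + (n * 21 + (7 + time)) ≤_)
    (solve 1 (λ x → (con 9 :+ ((con 1 :+ x) :* con 21 :+ (con 7 :+ (con 10 :+ ((con 1 :+ x) :* con 20 :+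
      (con 18 :+ ((con 1 :+ x) :* con 20 :+ con 5))))))) :+ con 49 :* x := con 110 :* (con 1 :+ x)) refl n′)
    (m≤m+n _ (49 * n′))
    where open +-*-Solver

  decision : Decided (110 * n) 0 (λ _ → 0)
  decision = weaken time-linear (steps 9 (Survey.survey (7 + time) verdict n′ {0} refl constants refl refl refl refl
    (record { agree = λ _ () ; differ = λ () }) (inj₂ λ ())))
    where
    constants : Constants (registersAfter 9 0 (λ _ → 0))
    constants = refl , refl , n-at , u-at , refl , cong (2 +_) n-at ,
      cong (λ x → 2 + x + x) n-at , cong (λ x → 2 + x + x + x + 1) n-at , refl

theorem6 : (k : ℕ) → 2 ≤ k →
    Σ Program λ prog → Σ ℕ λ c →
    (n : ℕ) → 1 ≤ n → (P : Graph n) → IsPath P → (L : AdjacencyLists P) →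
    (I J : Subset n) → IsPathVertexCover k P I → IsPathVertexCover k P J →
    (u : ℕ) → 1 ≤ u →
    prog on encode L I J u decides Reconfigurable k P u I J within (c * n)
theorem6 k 2≤k = program k , 110 , λ where
  (suc n′) 1≤n P path L I J coverI coverJ u _ →
    decided⇒decides (program k) (encode L I J u) (Reconfigurable k P u I J)
      (Correctness.decision k {{>-nonZero (<-trans z<s 2≤k)}} (traversal 1≤n path) L I J coverI coverJ u
        (cell (encode L I J u)) (encode-represents L I J u))
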